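{- Let $n\ge 24$. For each integer $a$ with $3\le a\le \lfloor (n-15)/3\rfloor$ and $n-a\equiv 1\pmod 2$, every integer in the interval $\left[\binom{a-1}{2}+1,\ \binom{a}{2}\right]$ is an eigenvalue of $\mathrm{Cay}(S_n,T_n)$.
   Context: $S_n$ is the symmetric group on $\{1,\dots,n\}$ and $T_n\subseteq S_n$ is the set of all transpositions. The transposition graph $\mathrm{Cay}(S_n,T_n)$ is the Cayley graph with vertex set $S_n$ in which $f,g\in S_n$ are adjacent iff $fg^{ -1}\in T_n$. Its eigenvalues are the eigenvalues of its adjacency matrix. -}

module Defs where

open import Data.Nat using (ℕ; zero; suc; _<_; _<?_)
open import Data.Fin using (Fin; toℕ)
open import Data.Fin.Properties using (all?) renaming (_≟_ to _≟ᶠ_)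
open import Data.Fin.Permutation.Components using (transpose)
open import Data.Vec using (Vec; []; _∷_; lookup; tabulate)
open import Data.Vec.Properties using (≡-dec)
open import Data.List using (List; []; _∷_; concatMap; map; filter; allFin; foldr)
open import Data.List.Membership.Propositional using (_∈_)
open import Data.Integer using (+_)
open import Data.Rational using (ℚ; _/_; _+_; _*_; 0ℚ; 1ℚ)
open import Data.Product using (Σ; _×_; _,_; proj₁; proj₂)
open import Relation.Nullary using (Dec; does; ¬_)
open import Relation.Nullary.Decidable using (_→-dec_)
open import Data.Bool.ListAction using (any)
open import Relation.Binary.PropositionalEquality using (_≡_; _≢_)
open import Data.Bool using (Bool; if_then_else_)

-- A permutation of {1..n} (as Fin n) is represented by its table of values:
-- the vector (σ 0, …, σ (n-1)), required to be injective (hence bijective).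
IsPerm : {n : ℕ} → Vec (Fin n) n → Set
IsPerm {n} σ = (i j : Fin n) → lookup σ i ≡ lookup σ j → i ≡ j

isPerm? : {n : ℕ} (σ : Vec (Fin n) n) → Dec (IsPerm σ)
isPerm? σ = all? λ i → all? λ j → (lookup σ i ≟ᶠ lookup σ j) →-dec (i ≟ᶠ j)

allVecs : (n k : ℕ) → List (Vec (Fin n) k)
allVecs n zero = [] ∷ []
allVecs n (suc k) = concatMap (λ x → map (x ∷_) (allVecs n k)) (allFin n)

-- the symmetric group S_n, listed (each element exactly once)
Sym : (n : ℕ) → List (Vec (Fin n) n)
Sym n = filter isPerm? (allVecs n n)

_∘ₚ_ : {n : ℕ} → Vec (Fin n) n → Vec (Fin n) n → Vec (Fin n) n
σ ∘ₚ τ = tabulate (λ x → lookup σ (lookup τ x))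

transposition : {n : ℕ} → Fin n → Fin n → Vec (Fin n) n
transposition i j = tabulate (transpose i j)

Transpositions : (n : ℕ) → List (Vec (Fin n) n)
Transpositions n =
  concatMap (λ i → map (transposition i)
                       (filter (λ j → toℕ i <? toℕ j) (allFin n)))
            (allFin n)

-- adjacency in Cay(S_n, T_n): f ~ g iff f g⁻¹ ∈ T_n, i.e. f = t ∘ g for some t ∈ T_n
adjacentᵇ : {n : ℕ} → Vec (Fin n) n → Vec (Fin n) n → Bool
adjacentᵇ {n} f g =
  any (λ t → does (≡-dec _≟ᶠ_ f (t ∘ₚ g))) (Transpositions n)

adj : {n : ℕ} → Vec (Fin n) n → Vec (Fin n) n → ℚ
adj f g = if adjacentᵇ f g then 1ℚ else 0ℚ

sumℚ : {A : Set} → (A → ℚ) → List A → ℚ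
sumℚ h xs = foldr (λ x acc → h x + acc) 0ℚ xs

-- λ is an eigenvalue of the adjacency matrix A of Cay(S_n,T_n):
-- there is a nonzero vector v ∈ ℚ^{S_n} with A v = λ v.
-- (A is an integer matrix and λ rational, so this is the same as over ℝ or ℂ.)
IsCayEigenvalue : (n : ℕ) → ℚ → Set
IsCayEigenvalue n λ′ =
  Σ (Vec (Fin n) n → ℚ) λ v →
    (Σ (Vec (Fin n) n) λ f → (f ∈ Sym n) × (v f ≢ 0ℚ))
    × ((f : Vec (Fin n) n) → f ∈ Sym n →
         sumℚ (λ g → adj f g * v g) (Sym n) ≡ λ′ * v f)

ℕtoℚ : ℕ → ℚ
ℕtoℚ k = (+ k) / 1

{-# OPTIONS --safe #-}
module Submission where

-- For a Young diagram with column heights h₁ ≥ h₂ ≥ … the product of the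
-- Vandermonde determinants of its columns (a Specht polynomial), evaluated at
-- the inverse of a permutation, is an eigenvector. Transpositions within a
-- column of height h contribute -h(h-1)/2; for a box y and a column at least as
-- high as that of y, the transpositions of y with the boxes of this column add up
-- to 1, by Lagrange interpolation at the entries of the column. Hence the
-- eigenvalue is the sum of the contents of the boxes.
--
-- A hook with leg x and arm x + d has content sum dx + d(d+1)/2. Two nested hooks
-- with parameters d and d + 1 (in either order) and fixed total leg length P - d
-- reach almost every content 1 + d(P+2) + y with 0 ≤ y ≤ P + 1, and a small core
-- inside the two hooks reaches the missing ones, so that division by P + 2
-- yields a diagram for every content in the range.

-- All algebra is done over the integers and free of division, so that the interpolation identity
-- also holds at coinciding nodes; rationals enter only through the final embedding. Let `X` be the
-- total leg length, so that `P = X + d`. Two hooks with parameters `d` and `d + 1` have `2 * P + 3`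
-- boxes whatever `d` is, and their content sum is `d * X + (d + 1)² + y = 1 + d * (P + 2) +
-- y`, where `y` is the leg of the hook with parameter `d + 1`. Raising `d` by one thus moves the
-- window of contents by exactly `P + 2`. One spare box goes into the core when the size is
-- `2 * P + 4`. Nesting is the obstacle. The outer hook must exceed the inner one in both
-- directions, so the two orders leave a gap at `y = X / 2`, and no leg can be longer than `X`. The
-- cores that repair this need room of their own: `2 * d + 13 ≤ X`, and for `d = 0` at the end of
-- the window `16 ≤ X`. The bound `3 * a + 15 ≤ n` provides it: contents up to `a C 2` force `d`
-- below `a / 3`, while `P` is at least about `3 * a / 2`.

open import Defs
open import Data.Nat using (ℕ; zero; suc)

-- Sums over exchanges of entries, and the Specht polynomial as an eigenfunction.

module Exchanges where
  open import Data.Nat using (_≤_; z≤n; s≤s) renaming (_+_ to _+ⁿ_)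
  open import Data.Integer using (ℤ; +_; 0ℤ; 1ℤ; _+_; _*_; _-_; -_)
  open import Data.Integer.Properties
  open import Data.Integer.Tactic.RingSolver using (solve-∀)
  open import Data.Vec using (Vec; []; _∷_; _++_; take; drop)
  open import Data.Vec.Properties using (take++drop≡id)
  open import Data.List using (List; []; _∷_)
  open import Data.Nat.ListAction using (sum)
  open import Data.List.Relation.Unary.All using (All; []; _∷_)
  open import Data.Product using (∃-syntax; _×_; _,_)
  open import Data.Unit using (⊤; tt)
  open import Function using (_∘_)
  open import Relation.Binary.PropositionalEquality
  open ≡-Reasoning

  private variable
    n p q : ℕ

  -- Relational companion of `Σexchange`: the congruence lemmas hand a derivation to each summand,
  -- which is how antisymmetry and the product identities enter. In every case `c ∷ u′` is a
  -- rearrangement of `b ∷ u`.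
  data Exchange (b : ℤ) : ∀ {n} → Vec ℤ n → ℤ → Vec ℤ n → Set where
    here  : ∀ {n c} {u : Vec ℤ n} → Exchange b (c ∷ u) c (b ∷ u)
    there : ∀ {n c d} {u u′ : Vec ℤ n} → Exchange b u c u′ → Exchange b (d ∷ u) c (d ∷ u′)

  data Swap : ∀ {n} → Vec ℤ n → Vec ℤ n → Set where
    head : ∀ {n a c} {u u′ : Vec ℤ n} → Exchange a u c u′ → Swap (a ∷ u) (c ∷ u′)
    tail : ∀ {n d} {u u′ : Vec ℤ n} → Swap u u′ → Swap (d ∷ u) (d ∷ u′)

  Σexchange : ℤ → Vec ℤ n → (ℤ → Vec ℤ n → ℤ) → ℤ
  Σexchange b []      Ψ = 0ℤ
  Σexchange b (c ∷ u) Ψ = Ψ c (b ∷ u) + Σexchange b u (λ c′ u′ → Ψ c′ (c ∷ u′))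

  Σswap : Vec ℤ n → (Vec ℤ n → ℤ) → ℤ
  Σswap []      Φ = 0ℤ
  Σswap (a ∷ u) Φ = Σexchange a u (λ c u′ → Φ (c ∷ u′)) + Σswap u (λ u′ → Φ (a ∷ u′))

  -- The recursion is on `w`, so that each summand is a full sum over `u` for one fixed outside
  -- entry `b`, the shape that `interpolation` evaluates.
  Σcross : Vec ℤ p → Vec ℤ q → (Vec ℤ p → Vec ℤ q → ℤ) → ℤ
  Σcross u []      Φ = 0ℤ
  Σcross u (b ∷ w) Φ = Σexchange b u (λ c u′ → Φ u′ (c ∷ w)) + Σcross u w (λ u′ w′ → Φ u′ (b ∷ w′))

  Σexchange-cong : ∀ b (u : Vec ℤ n) {Ψ Ψ′} → (∀ {c u′} → Exchange b u c u′ → Ψ c u′ ≡ Ψ′ c u′) →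
                   Σexchange b u Ψ ≡ Σexchange b u Ψ′
  Σexchange-cong b []      eq = refl
  Σexchange-cong b (c ∷ u) eq = cong₂ _+_ (eq here) (Σexchange-cong b u (eq ∘ there))

  Σswap-cong : ∀ (u : Vec ℤ n) {Φ Φ′} → (∀ {u′} → Swap u u′ → Φ u′ ≡ Φ′ u′) → Σswap u Φ ≡ Σswap u Φ′
  Σswap-cong []      eq = refl
  Σswap-cong (a ∷ u) eq = cong₂ _+_ (Σexchange-cong a u (eq ∘ head)) (Σswap-cong u (eq ∘ tail))

  Σcross-cong : ∀ (u : Vec ℤ p) (w : Vec ℤ q) {Φ Φ′} → (∀ u′ w′ → Φ u′ w′ ≡ Φ′ u′ w′) →
                Σcross u w Φ ≡ Σcross u w Φ′
  Σcross-cong u []      eq = refl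
  Σcross-cong u (b ∷ w) eq =
    cong₂ _+_ (Σexchange-cong b u (λ _ → eq _ _)) (Σcross-cong u w (λ u′ w′ → eq u′ (b ∷ w′)))

  Σexchange-const : ∀ b (u : Vec ℤ n) {Ψ x} → (∀ {c u′} → Exchange b u c u′ → Ψ c u′ ≡ x) →
                    Σexchange b u Ψ ≡ + n * x
  Σexchange-const b []      {x = x} eq = refl
  Σexchange-const {suc n} b (c ∷ u) {x = x} eq =
    trans (cong₂ _+_ (eq here) (Σexchange-const b u (eq ∘ there))) (sym (suc-* (+ n) x))

  triangle : ℕ → ℕ
  triangle zero    = 0
  triangle (suc n) = n +ⁿ triangle n

  Σswap-const : ∀ (u : Vec ℤ n) {Φ x} → (∀ {u′} → Swap u u′ → Φ u′ ≡ x) → Σswap u Φ ≡ + triangle n * x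
  Σswap-const []      {x = x} eq = refl
  Σswap-const {suc n} (a ∷ u) {x = x} eq = begin
    _                                     ≡⟨ cong₂ _+_ (Σexchange-const a u (eq ∘ head)) (Σswap-const u (eq ∘ tail)) ⟩
    + n * x + + triangle n * x            ≡⟨ *-distribʳ-+ x (+ n) (+ triangle n) ⟨
    (+ n + + triangle n) * x              ∎

  Σexchange-++ : ∀ b (u : Vec ℤ p) (w : Vec ℤ q) Ψ → Σexchange b (u ++ w) Ψ ≡
    Σexchange b u (λ c u′ → Ψ c (u′ ++ w)) + Σexchange b w (λ c w′ → Ψ c (u ++ w′))
  Σexchange-++ b []      w Ψ = sym (+-identityˡ _)
  Σexchange-++ b (c ∷ u) w Ψ =
    trans (cong (λ z → Ψ c (b ∷ (u ++ w)) + z) (Σexchange-++ b u w (λ c′ u′ → Ψ c′ (c ∷ u′))))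
          (sym (+-assoc (Ψ c (b ∷ (u ++ w))) _ _))

  Σcross-∷ : ∀ a (u : Vec ℤ p) (w : Vec ℤ q) Φ → Σcross (a ∷ u) w Φ ≡
    Σexchange a w (λ c w′ → Φ (c ∷ u) w′) + Σcross u w (λ u′ w′ → Φ (a ∷ u′) w′)
  Σcross-∷ a u []      Φ = refl
  Σcross-∷ a u (b ∷ w) Φ = 
    trans (cong (λ z → (Φ (b ∷ u) (a ∷ w) + exchanged) + z) (Σcross-∷ a u w (λ u′ w′ → Φ u′ (b ∷ w′))))
          (interchange (Φ (b ∷ u) (a ∷ w)) exchanged _ _)
    where
    exchanged = Σexchange b u (λ c u′ → Φ (a ∷ u′) (c ∷ w))
    interchange : ∀ x y z t → (x + y) + (z + t) ≡ (x + z) + (y + t)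
    interchange = solve-∀

  Σcross-[] : ∀ (w : Vec ℤ q) Φ → Σcross [] w Φ ≡ 0ℤ
  Σcross-[] []      Φ = refl
  Σcross-[] (b ∷ w) Φ = trans (+-identityˡ _) (Σcross-[] w _)

  Σswap-++ : ∀ (u : Vec ℤ p) (w : Vec ℤ q) Φ → Σswap (u ++ w) Φ ≡
    (Σswap u (λ u′ → Φ (u′ ++ w)) + Σcross u w (λ u′ w′ → Φ (u′ ++ w′))) + Σswap w (λ w′ → Φ (u ++ w′))
  Σswap-++ []      w Φ =
    sym (trans (cong (λ x → (0ℤ + x) + Σswap w Φ) (Σcross-[] w _)) (+-identityˡ _))
  Σswap-++ (a ∷ u) w Φ = begin
    Σexchange a (u ++ w) (λ c v → Φ (c ∷ v)) + Σswap (u ++ w) (λ v → Φ (a ∷ v))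
      ≡⟨ cong₂ _+_ (Σexchange-++ a u w _) (Σswap-++ u w _) ⟩
    (e + f) + ((g + h) + i)
      ≡⟨ rearrange e f g h i ⟩
    ((e + g) + (f + h)) + i
      ≡⟨ cong (λ x → ((e + g) + x) + i) (Σcross-∷ a u w (λ u′ w′ → Φ (u′ ++ w′))) ⟨
    _ ∎
    where
    e = Σexchange a u (λ c u′ → Φ (c ∷ u′ ++ w))
    f = Σexchange a w (λ c w′ → Φ (c ∷ u ++ w′))
    g = Σswap u (λ u′ → Φ (a ∷ u′ ++ w))
    h = Σcross u w (λ u′ w′ → Φ (a ∷ u′ ++ w′))
    i = Σswap w (λ w′ → Φ (a ∷ u ++ w′))
    rearrange : ∀ e f g h i → (e + f) + ((g + h) + i) ≡ ((e + g) + (f + h)) + i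
    rearrange = solve-∀

  Σexchange-*ˡ : ∀ k b (u : Vec ℤ n) Ψ → Σexchange b u (λ c u′ → k * Ψ c u′) ≡ k * Σexchange b u Ψ
  Σexchange-*ˡ k b []      Ψ = sym (*-zeroʳ k)
  Σexchange-*ˡ k b (c ∷ u) Ψ =
    trans (cong (λ z → k * Ψ c (b ∷ u) + z) (Σexchange-*ˡ k b u (λ c′ u′ → Ψ c′ (c ∷ u′))))
          (sym (*-distribˡ-+ k (Ψ c (b ∷ u)) _))

  Σswap-*ˡ : ∀ k (u : Vec ℤ n) Φ → Σswap u (λ u′ → k * Φ u′) ≡ k * Σswap u Φ
  Σswap-*ˡ k []      Φ = sym (*-zeroʳ k)
  Σswap-*ˡ k (a ∷ u) Φ = trans (cong₂ _+_ (Σexchange-*ˡ k a u _) (Σswap-*ˡ k u _))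
    (sym (*-distribˡ-+ k (Σexchange a u (λ c u′ → Φ (c ∷ u′))) _))

  -- Vandermonde products and their antisymmetry.

  ∏diff : ℤ → Vec ℤ n → ℤ
  ∏diff t []      = 1ℤ
  ∏diff t (c ∷ u) = (t - c) * ∏diff t u

  vandermonde : Vec ℤ n → ℤ
  vandermonde []      = 1ℤ
  vandermonde (a ∷ u) = ∏diff a u * vandermonde u

  -- Both sides are the product of `a - e` over all entries `e` of `b ∷ u`, of which `c ∷ u′` is a
  -- rearrangement.
  ∏diff-exchange : ∀ a {b c} {u u′ : Vec ℤ n} → Exchange b u c u′ →
                   (a - c) * ∏diff a u′ ≡ (a - b) * ∏diff a u
  ∏diff-exchange a {b} {c} {_ ∷ u} here = swap (a - c) (a - b) (∏diff a u)
    where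
    swap : ∀ x y z → x * (y * z) ≡ y * (x * z)
    swap = solve-∀
  ∏diff-exchange a {b} {c} {d ∷ u} {_ ∷ u′} (there e) = begin
    (a - c) * ((a - d) * ∏diff a u′)  ≡⟨ swap (a - c) (a - d) _ ⟩
    (a - d) * ((a - c) * ∏diff a u′)  ≡⟨ cong ((a - d) *_) (∏diff-exchange a e) ⟩
    (a - d) * ((a - b) * ∏diff a u)   ≡⟨ swap (a - d) (a - b) _ ⟩
    (a - b) * ((a - d) * ∏diff a u)   ∎
    where
    swap : ∀ x y z → x * (y * z) ≡ y * (x * z)
    swap = solve-∀

  ∏diff-swap : ∀ a {u u′ : Vec ℤ n} → Swap u u′ → ∏diff a u′ ≡ ∏diff a u
  ∏diff-swap a (head e)         = ∏diff-exchange a e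
  ∏diff-swap a (tail {d = d} s) = cong ((a - d) *_) (∏diff-swap a s)

  vandermonde-exchange : ∀ {b c} {u u′ : Vec ℤ n} → Exchange b u c u′ →
                         vandermonde (c ∷ u′) ≡ - vandermonde (b ∷ u)
  vandermonde-exchange {b = b} {c} {_ ∷ u} here = lemma b c (∏diff c u) (∏diff b u) (vandermonde u)
    where
    lemma : ∀ b c x y z → ((c - b) * x) * (y * z) ≡ - (((b - c) * y) * (x * z))
    lemma = solve-∀
  vandermonde-exchange {b = b} {c} {d ∷ u} {_ ∷ u′} (there e) = begin
    ((c - d) * ∏diff c u′) * (∏diff d u′ * vandermonde u′)
      ≡⟨ lemma₁ c d (∏diff c u′) (∏diff d u′) (vandermonde u′) ⟩
    - (((d - c) * ∏diff d u′) * (∏diff c u′ * vandermonde u′))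
      ≡⟨ cong -_ (cong₂ _*_ (∏diff-exchange d e) (vandermonde-exchange e)) ⟩
    - (((d - b) * ∏diff d u) * - (∏diff b u * vandermonde u))
      ≡⟨ lemma₂ b d (∏diff d u) (∏diff b u) (vandermonde u) ⟩
    - (((b - d) * ∏diff b u) * (∏diff d u * vandermonde u)) ∎
    where
    lemma₁ : ∀ c d x y z → ((c - d) * x) * (y * z) ≡ - (((d - c) * y) * (x * z))
    lemma₁ = solve-∀
    lemma₂ : ∀ b d x y z → - (((d - b) * x) * - (y * z)) ≡ - (((b - d) * y) * (x * z))
    lemma₂ = solve-∀

  vandermonde-swap : ∀ {u u′ : Vec ℤ n} → Swap u u′ → vandermonde u′ ≡ - vandermonde u
  vandermonde-swap (head e) = vandermonde-exchange e
  vandermonde-swap {u = d ∷ u} (tail s) =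
    trans (cong₂ _*_ (∏diff-swap d s) (vandermonde-swap s)) (sym (neg-distribʳ-* (∏diff d u) _))

  Σswap-vandermonde : ∀ (u : Vec ℤ n) → Σswap u vandermonde ≡ + triangle n * - vandermonde u
  Σswap-vandermonde u = Σswap-const u vandermonde-swap

  -- Polynomial functions of degree less than the index, in nested Newton form. The centres are
  -- arbitrary, so a function can be expanded again at whichever node is needed, and no coefficients
  -- have to be compared.
  data Poly : ℕ → (ℤ → ℤ) → Set where
    zeroᵖ : ∀ {P} → (∀ t → P t ≡ 0ℤ) → Poly 0 P
    sucᵖ  : ∀ {n P Q} s c → Poly n Q → (∀ t → P t ≡ c + (t - s) * Q t) → Poly (suc n) P

  Poly-divide : ∀ {P} → Poly (suc n) P → ∀ a → ∃[ Q ] Poly n Q × (∀ t → P t ≡ P a + (t - a) * Q t)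
  Poly-divide {P = P} (sucᵖ {Q = Q} s c (zeroᵖ Q≡0) eq) a = Q , zeroᵖ Q≡0 , λ t → begin
    P t                       ≡⟨ eq t ⟩
    c + (t - s) * Q t         ≡⟨ cong (λ x → c + (t - s) * x) (Q≡0 t) ⟩
    c + (t - s) * 0ℤ          ≡⟨ lemma a c s t ⟩
    (c + (a - s) * 0ℤ) + (t - a) * 0ℤ
      ≡⟨ cong₂ (λ x y → (c + (a - s) * x) + (t - a) * y) (Q≡0 a) (Q≡0 t) ⟨
    (c + (a - s) * Q a) + (t - a) * Q t  ≡⟨ cong (_+ (t - a) * Q t) (eq a) ⟨
    P a + (t - a) * Q t       ∎
    where
    lemma : ∀ a c s t → c + (t - s) * 0ℤ ≡ (c + (a - s) * 0ℤ) + (t - a) * 0ℤ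
    lemma = solve-∀
  Poly-divide {P = P} (sucᵖ {Q = Q} s c q@(sucᵖ _ _ _ _) eq) a with Poly-divide q a
  -- Leibniz rule for divided differences: the quotient of `(t - s) * Q t` at `a` is
  -- `Q a + (t - s) * Q′ t`.
  ... | Q′ , q′ , eq′ = _ , sucᵖ s (Q a) q′ (λ t → refl) , λ t → begin
    P t                                        ≡⟨ eq t ⟩
    c + (t - s) * Q t                          ≡⟨ cong (λ x → c + (t - s) * x) (eq′ t) ⟩
    c + (t - s) * (Q a + (t - a) * Q′ t)       ≡⟨ lemma a c s t (Q a) (Q′ t) ⟩
    (c + (a - s) * Q a) + (t - a) * (Q a + (t - s) * Q′ t)
      ≡⟨ cong (_+ (t - a) * (Q a + (t - s) * Q′ t)) (eq a) ⟨
    P a + (t - a) * (Q a + (t - s) * Q′ t)     ∎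
    where
    lemma : ∀ a c s t x y → c + (t - s) * (x + (t - a) * y) ≡ (c + (a - s) * x) + (t - a) * (x + (t - s) * y)
    lemma = solve-∀

  Poly-resp : ∀ {P P′} → (∀ t → P t ≡ P′ t) → Poly n P → Poly n P′
  Poly-resp eq (zeroᵖ P≡0)    = zeroᵖ (λ t → trans (sym (eq t)) (P≡0 t))
  Poly-resp eq (sucᵖ s c q h) = sucᵖ s c q (λ t → trans (sym (eq t)) (h t))

  Poly-*ˡ : ∀ k {P} → Poly n P → Poly n (λ t → k * P t)
  Poly-*ˡ k (zeroᵖ P≡0)            = zeroᵖ (λ t → trans (cong (k *_) (P≡0 t)) (*-zeroʳ k))
  Poly-*ˡ k (sucᵖ {Q = Q} s c q h) =
    sucᵖ s (k * c) (Poly-*ˡ k q) (λ t → trans (cong (k *_) (h t)) (lemma k c s t (Q t)))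
    where
    lemma : ∀ k c s t x → k * (c + (t - s) * x) ≡ k * c + (t - s) * (k * x)
    lemma = solve-∀

  Poly-+ : ∀ {P P′} → Poly n P → Poly n P′ → Poly n (λ t → P t + P′ t)
  Poly-+ (zeroᵖ P≡0) (zeroᵖ P′≡0) = zeroᵖ (λ t → cong₂ _+_ (P≡0 t) (P′≡0 t))
  Poly-+ {P′ = P′} (sucᵖ {Q = Q} s c q h) r with Poly-divide r s
  ... | Q′ , q′ , h′ =
    sucᵖ s (c + P′ s) (Poly-+ q q′) (λ t → trans (cong₂ _+_ (h t) (h′ t)) (lemma c (P′ s) s t (Q t) (Q′ t)))
    where
    lemma : ∀ c c′ s t x y → (c + (t - s) * x) + (c′ + (t - s) * y) ≡ (c + c′) + (t - s) * (x + y)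
    lemma = solve-∀

  Poly-0 : ∀ n {P} → (∀ t → P t ≡ 0ℤ) → Poly n P
  Poly-0 zero    P≡0 = zeroᵖ P≡0
  Poly-0 (suc n) P≡0 = sucᵖ 0ℤ 0ℤ (Poly-0 n (λ _ → refl)) (λ t →
    trans (P≡0 t) (sym (trans (+-identityˡ _) (*-zeroʳ (t - 0ℤ)))))

  Poly-mono : ∀ {m n P} → m ≤ n → Poly m P → Poly n P
  Poly-mono {n = n} z≤n (zeroᵖ P≡0)      = Poly-0 n P≡0
  Poly-mono (s≤s m≤n)   (sucᵖ s c q h) = sucᵖ s c (Poly-mono m≤n q) h

  Poly-root : ∀ c {P} → Poly n P → Poly (suc n) (λ t → (t - c) * P t)
  Poly-root c p = sucᵖ c 0ℤ p (λ t → sym (+-identityˡ _))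

  Poly-const : ∀ c → Poly (suc n) (λ _ → c)
  Poly-const {n} c =
    sucᵖ 0ℤ c (Poly-0 n (λ _ → refl)) (λ t → sym (trans (cong (λ z → c + z) (*-zeroʳ (t - 0ℤ))) (+-identityʳ c)))

  Poly-∏diff : ∀ (u : Vec ℤ n) → Poly (suc n) (λ t → ∏diff t u)
  Poly-∏diff []      = Poly-const 1ℤ
  Poly-∏diff (c ∷ u) = Poly-root c (Poly-∏diff u)

  -- the polynomial (∏ (t - c) - ∏ (a - c)) / (t - a)
  quotient : ℤ → Vec ℤ n → ℤ → ℤ
  quotient a []      t = 0ℤ
  quotient a (c ∷ u) t = (t - c) * quotient a u t + ∏diff a u

  quotient-spec : ∀ a (u : Vec ℤ n) t → ∏diff a u ≡ ∏diff t u + (a - t) * quotient a u t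
  quotient-spec a []      t = sym (cong (λ z → 1ℤ + z) (*-zeroʳ (a - t)))
  quotient-spec a (c ∷ u) t = begin
    (a - c) * A                                    ≡⟨ lemma₁ a c t A ⟩
    (t - c) * A + (a - t) * A                      ≡⟨ cong (λ x → (t - c) * x + (a - t) * A) (quotient-spec a u t) ⟩
    (t - c) * (∏diff t u + (a - t) * D) + (a - t) * A
      ≡⟨ lemma₂ a c t A (∏diff t u) D ⟩
    (t - c) * ∏diff t u + (a - t) * ((t - c) * D + A) ∎
    where
    A = ∏diff a u
    D = quotient a u t
    lemma₁ : ∀ a c t x → (a - c) * x ≡ (t - c) * x + (a - t) * x
    lemma₁ = solve-∀
    lemma₂ : ∀ a c t x y z → (t - c) * (y + (a - t) * z) + (a - t) * x ≡ (t - c) * y + (a - t) * ((t - c) * z + x)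
    lemma₂ = solve-∀

  Poly-quotient : ∀ a (u : Vec ℤ n) → Poly n (quotient a u)
  Poly-quotient a []      = zeroᵖ (λ _ → refl)
  Poly-quotient a (c ∷ u) = Poly-+ (Poly-root c (Poly-quotient a u)) (Poly-const (∏diff a u))

  -- Since `c` is an entry of `u`, `∏diff c u` vanishes, and `quotient a u c` is the product of
  -- `a - e` over the remaining entries. As a polynomial identity this survives `a = c`, where
  -- division by `a - c` would not make sense.
  ∏diff-quotient : ∀ a {b c} {u u′ : Vec ℤ n} → Exchange b u c u′ → ∏diff a u′ ≡ (a - b) * quotient a u c
  ∏diff-quotient a {b} {c} {_ ∷ u} here = lemma a b c (∏diff a u) (quotient a u c)
    where
    lemma : ∀ a b c x y → (a - b) * x ≡ (a - b) * ((c - c) * y + x)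
    lemma = solve-∀
  ∏diff-quotient a {b} {c} {d ∷ u} {_ ∷ u′} (there e) = begin
    (a - d) * ∏diff a u′                          ≡⟨ lemma₁ a c d (∏diff a u′) ⟩
    (c - d) * ∏diff a u′ + (a - c) * ∏diff a u′
      ≡⟨ cong₂ (λ x y → (c - d) * x + y) (∏diff-quotient a e) (∏diff-exchange a e) ⟩
    (c - d) * ((a - b) * quotient a u c) + (a - b) * ∏diff a u
      ≡⟨ lemma₂ (a - b) (c - d) (quotient a u c) (∏diff a u) ⟩
    (a - b) * ((c - d) * quotient a u c + ∏diff a u) ∎
    where
    lemma₁ : ∀ a c d x → (a - d) * x ≡ (c - d) * x + (a - c) * x
    lemma₁ = solve-∀
    lemma₂ : ∀ k d x y → d * (k * x) + k * y ≡ k * (d * x + y)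
    lemma₂ = solve-∀

  -- Lagrange interpolation at the nodes u, multiplied by the Vandermonde
  -- determinant; in this form the nodes need not be distinct.
  interpolation : ∀ b (u : Vec ℤ n) {P} → Poly n P →
                  Σexchange b u (λ c u′ → vandermonde u′ * P c) ≡ vandermonde u * P b
  interpolation b [] (zeroᵖ P≡0) = sym (cong (1ℤ *_) (P≡0 b))
  interpolation b (a ∷ u) {P} p with Poly-divide p a
  ... | Q , q , P≡ = begin
    (∏diff b u * V) * P a + Σexchange b u (λ c u′ → (∏diff a u′ * vandermonde u′) * P c)
      ≡⟨ cong (λ z → (∏diff b u * V) * P a + z) (Σexchange-cong b u step) ⟩
    (∏diff b u * V) * P a + Σexchange b u (λ c u′ → vandermonde u′ * R c)
      ≡⟨ cong (λ z → (∏diff b u * V) * P a + z) (interpolation b u R-poly) ⟩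
    (∏diff b u * V) * P a + V * R b
      ≡⟨ lemma₁ a b (∏diff b u) V (P a) (quotient a u b) (∏diff a u) (Q b) ⟩
    V * ((∏diff b u + (a - b) * quotient a u b) * P a + ∏diff a u * ((b - a) * Q b))
      ≡⟨ cong (λ x → V * (x * P a + ∏diff a u * ((b - a) * Q b))) (quotient-spec a u b) ⟨
    V * (∏diff a u * P a + ∏diff a u * ((b - a) * Q b))
      ≡⟨ lemma₂ V (∏diff a u) (P a) _ ⟩
    (∏diff a u * V) * (P a + (b - a) * Q b)
      ≡⟨ cong (∏diff a u * V *_) (P≡ b) ⟨
    (∏diff a u * V) * P b ∎
    where
    V = vandermonde u
    -- `R c` equals `∏diff a u′ * P c` at the nodes. In `P c = P a + (c - a) * Q c`, the first term
    -- uses `∏diff-quotient`, and in the second the factor `c - a` is absorbed by `∏diff-exchange`.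
    -- The degree bound of `R` is one lower than that of `P`, matching the loss of the node `a`.
    R : ℤ → ℤ
    R t = ((a - b) * P a) * quotient a u t + ((b - a) * ∏diff a u) * Q t
    R-poly : Poly _ R
    R-poly = Poly-+ (Poly-*ˡ ((a - b) * P a) (Poly-quotient a u)) (Poly-*ˡ ((b - a) * ∏diff a u) q)
    lemma₁ : ∀ a b x v y z w r → (x * v) * y + v * (((a - b) * y) * z + ((b - a) * w) * r) ≡
             v * ((x + (a - b) * z) * y + w * ((b - a) * r))
    lemma₁ = solve-∀
    lemma₂ : ∀ v x y z → v * (x * y + x * z) ≡ (x * v) * (y + z)
    lemma₂ = solve-∀
    lemma₃ : ∀ a c x v y z → (x * v) * (y + (c - a) * z) ≡ v * (y * x - z * ((a - c) * x))
    lemma₃ = solve-∀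
    lemma₄ : ∀ a b v y d w z → v * (y * ((a - b) * d) - z * ((a - b) * w)) ≡
             v * (((a - b) * y) * d + ((b - a) * w) * z)
    lemma₄ = solve-∀
    step : ∀ {c u′} → Exchange b u c u′ → (∏diff a u′ * vandermonde u′) * P c ≡ vandermonde u′ * R c
    step {c} {u′} e = begin
      (∏diff a u′ * vandermonde u′) * P c
        ≡⟨ cong (∏diff a u′ * vandermonde u′ *_) (P≡ c) ⟩
      (∏diff a u′ * vandermonde u′) * (P a + (c - a) * Q c)
        ≡⟨ lemma₃ a c (∏diff a u′) (vandermonde u′) (P a) (Q c) ⟩
      vandermonde u′ * (P a * ∏diff a u′ - Q c * ((a - c) * ∏diff a u′))
        ≡⟨ cong₂ (λ x y → vandermonde u′ * (P a * x - Q c * y)) (∏diff-quotient a e) (∏diff-exchange a e) ⟩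
      vandermonde u′ * (P a * ((a - b) * quotient a u c) - Q c * ((a - b) * ∏diff a u))
        ≡⟨ lemma₄ a b (vandermonde u′) (P a) (quotient a u c) (∏diff a u) (Q c) ⟩
      vandermonde u′ * R c ∎

  -- Degree less than `p` in each variable with the others frozen. A mixed exchange alters a single
  -- entry outside the column, so interpolation asks for no joint degree bound.
  SepPoly : ℕ → ∀ n → (Vec ℤ n → ℤ) → Set
  SepPoly p zero    H = ⊤
  SepPoly p (suc n) H = (∀ w → Poly p (λ t → H (t ∷ w))) × (∀ b → SepPoly p n (λ w → H (b ∷ w)))

  -- The length `p` of the column is both the number of nodes and the degree bound, so each of the
  -- `q` outside entries contributes exactly `vandermonde u * H w`.
  Σcross-vandermonde : ∀ (u : Vec ℤ p) (w : Vec ℤ q) {H} → SepPoly p q H →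
                       Σcross u w (λ u′ w′ → vandermonde u′ * H w′) ≡ + q * (vandermonde u * H w)
  Σcross-vandermonde u []      _             = refl
  Σcross-vandermonde {q = suc q} u (b ∷ w) (hd , tl) =
    trans (cong₂ _+_ (interpolation b u (hd w)) (Σcross-vandermonde u w (tl b)))
          (sym (suc-* (+ q) _))

  SepPoly-resp : ∀ n {H H′} → (∀ w → H w ≡ H′ w) → SepPoly p n H → SepPoly p n H′
  SepPoly-resp zero    eq _         = tt
  SepPoly-resp (suc n) eq (hd , tl) =
    (λ w → Poly-resp (λ t → eq (t ∷ w)) (hd w)) , (λ b → SepPoly-resp n (λ w → eq (b ∷ w)) (tl b))

  SepPoly-*ˡ : ∀ n k {H} → SepPoly p n H → SepPoly p n (λ w → k * H w)
  SepPoly-*ˡ zero    k _         = tt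
  SepPoly-*ˡ (suc n) k (hd , tl) = (λ w → Poly-*ˡ k (hd w)) , (λ b → SepPoly-*ˡ n k (tl b))

  SepPoly-mono : ∀ {p p′} n {H} → p ≤ p′ → SepPoly p n H → SepPoly p′ n H
  SepPoly-mono zero    le _         = tt
  SepPoly-mono (suc n) le (hd , tl) = (λ w → Poly-mono le (hd w)) , (λ b → SepPoly-mono n le (tl b))

  SepPoly-∏diff : ∀ n a {H} → SepPoly p n H → SepPoly (suc p) n (λ w → ∏diff a w * H w)
  SepPoly-∏diff zero    a _         = tt
  SepPoly-∏diff (suc n) a {H} (hd , tl) =
    (λ w → Poly-resp (λ t → lemma₁ a t (∏diff a w) (H (t ∷ w))) (Poly-*ˡ (- ∏diff a w) (Poly-root a (hd w)))) ,
    (λ b → SepPoly-resp n (λ w → lemma₂ (a - b) (∏diff a w) (H (b ∷ w)))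
             (SepPoly-*ˡ n (a - b) (SepPoly-∏diff n a (tl b))))
    where
    lemma₁ : ∀ a t x y → - x * ((t - a) * y) ≡ ((a - t) * x) * y
    lemma₁ = solve-∀
    lemma₂ : ∀ k x y → k * (x * y) ≡ (k * x) * y
    lemma₂ = solve-∀

  SepPoly-vandermonde : ∀ n → SepPoly n n vandermonde
  SepPoly-vandermonde zero    = tt
  SepPoly-vandermonde (suc n) =
    (λ w → Poly-resp (λ t → *-comm (vandermonde w) (∏diff t w)) (Poly-*ˡ (vandermonde w) (Poly-∏diff w))) ,
    (λ b → SepPoly-∏diff n b (SepPoly-vandermonde n))

  take-++ : ∀ m (u : Vec ℤ m) (w : Vec ℤ n) → take m (u ++ w) ≡ u
  take-++ zero    []      w = refl
  take-++ (suc m) (x ∷ u) w = cong (x ∷_) (take-++ m u w)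

  drop-++ : ∀ m (u : Vec ℤ m) (w : Vec ℤ n) → drop m (u ++ w) ≡ w
  drop-++ zero    []      w = refl
  drop-++ (suc m) (x ∷ u) w = drop-++ m u w

  SepPoly-++ : ∀ m n {G H} → SepPoly p m G → SepPoly p n H →
               SepPoly p (m +ⁿ n) (λ w → G (take m w) * H (drop m w))
  SepPoly-++ zero    n {G} g h = SepPoly-*ˡ n (G []) h
  SepPoly-++ (suc m) n {G} {H} (hd , tl) h =
    (λ w → Poly-resp (λ t → *-comm (H (drop m w)) _) (Poly-*ˡ (H (drop m w)) (hd (take m w)))) ,
    (λ b → SepPoly-++ m n (tl b) h)

  -- The product of the Vandermonde determinants of the columns of a diagram
  -- with column heights hs, filled with w column by column (a Specht polynomial).
  specht : ∀ hs → Vec ℤ (sum hs) → ℤ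
  specht []       w = 1ℤ
  specht (h ∷ hs) w = vandermonde (take h w) * specht hs (drop h w)

  data Descending : List ℕ → Set where
    []  : Descending []
    _∷_ : ∀ {h hs} → All (_≤ h) hs → Descending hs → Descending (h ∷ hs)

  -- sum of the contents (column - row) over the boxes of the diagram
  content : List ℕ → ℤ
  content []       = 0ℤ
  content (h ∷ hs) = (+ sum hs - + triangle h) + content hs

  SepPoly-specht : ∀ hs → All (_≤ p) hs → SepPoly p (sum hs) (specht hs)
  SepPoly-specht []       []         = tt
  SepPoly-specht (h ∷ hs) (le ∷ les) =
    SepPoly-++ h (sum hs) (SepPoly-mono h le (SepPoly-vandermonde h)) (SepPoly-specht hs les)

  specht-++ : ∀ h hs (u : Vec ℤ h) (w : Vec ℤ (sum hs)) →
              specht (h ∷ hs) (u ++ w) ≡ vandermonde u * specht hs w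
  specht-++ h hs u w = cong₂ _*_ (cong vandermonde (take-++ h u w)) (cong (specht hs) (drop-++ h u w))

  Σswap-specht : ∀ {hs} → Descending hs → (w : Vec ℤ (sum hs)) → Σswap w (specht hs) ≡ content hs * specht hs w
  Σswap-specht []  [] = refl
  Σswap-specht {h ∷ hs} (les ∷ desc) w = subst (λ v → Σswap v (specht (h ∷ hs)) ≡ content (h ∷ hs) * specht (h ∷ hs) v)
    (take++drop≡id h w) (split (take h w) (drop h w))
    where
    split : ∀ u v → Σswap (u ++ v) (specht (h ∷ hs)) ≡ content (h ∷ hs) * specht (h ∷ hs) (u ++ v)
    split u v = begin
      Σswap (u ++ v) (specht (h ∷ hs))
        ≡⟨ Σswap-++ u v _ ⟩
      (Σswap u (λ u′ → specht (h ∷ hs) (u′ ++ v)) + Σcross u v (λ u′ v′ → specht (h ∷ hs) (u′ ++ v′)))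
        + Σswap v (λ v′ → specht (h ∷ hs) (u ++ v′))
        ≡⟨ cong₂ _+_ (cong₂ _+_ within across) beyond ⟩
      (F * (+ triangle h * - V) + + sum hs * (V * F)) + V * (content hs * F)
        ≡⟨ lemma F V (+ triangle h) (+ sum hs) (content hs) ⟩
      content (h ∷ hs) * (V * F)
        ≡⟨ cong (content (h ∷ hs) *_) (specht-++ h hs u v) ⟨
      content (h ∷ hs) * specht (h ∷ hs) (u ++ v) ∎
      where
      V = vandermonde u
      F = specht hs v
      within : Σswap u (λ u′ → specht (h ∷ hs) (u′ ++ v)) ≡ F * (+ triangle h * - V)
      within = begin
        Σswap u (λ u′ → specht (h ∷ hs) (u′ ++ v))
          ≡⟨ Σswap-cong u (λ {u′} _ → trans (specht-++ h hs u′ v) (*-comm (vandermonde u′) F)) ⟩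
        Σswap u (λ u′ → F * vandermonde u′)  ≡⟨ Σswap-*ˡ F u vandermonde ⟩
        F * Σswap u vandermonde              ≡⟨ cong (F *_) (Σswap-vandermonde u) ⟩
        F * (+ triangle h * - V)             ∎
      across : Σcross u v (λ u′ v′ → specht (h ∷ hs) (u′ ++ v′)) ≡ + sum hs * (V * F)
      -- The descending order enters here: `specht hs` has degree below the height of the respective
      -- column in each variable, and that height is at most `h`.
      across = trans (Σcross-cong u v (specht-++ h hs)) (Σcross-vandermonde u v (SepPoly-specht hs les))
      beyond : Σswap v (λ v′ → specht (h ∷ hs) (u ++ v′)) ≡ V * (content hs * F)
      beyond = begin
        Σswap v (λ v′ → specht (h ∷ hs) (u ++ v′))  ≡⟨ Σswap-cong v (λ {v′} _ → specht-++ h hs u v′) ⟩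
        Σswap v (λ v′ → V * specht hs v′)           ≡⟨ Σswap-*ˡ V v (specht hs) ⟩
        V * Σswap v (specht hs)                     ≡⟨ cong (V *_) (Σswap-specht desc v) ⟩
        V * (content hs * F)                        ∎
      lemma : ∀ f v t s c → (f * (t * - v) + s * (v * f)) + v * (c * f) ≡ ((s - t) + c) * (v * f)
      lemma = solve-∀

-- From the adjacency matrix to sums over transpositions.

module Transposed where
  open Exchanges using (Σexchange; Σswap)
  open import Data.Nat using (_<_; _<?_; z<s; s<s)
  open import Data.Nat.Properties using (n≮n; <-asym)
  open import Data.Integer using (ℤ; 0ℤ; _+_)
  open import Data.Integer.Properties using (+-assoc; +-identityˡ)
  open import Data.Bool using (Bool; true; false; T; if_then_else_)
  open import Data.Fin using (Fin; zero; suc; toℕ; punchOut)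
  open import Data.Fin.Properties using (any?; _≟_; punchOut-injective; injective⇒≤)
  open import Data.Fin.Permutation.Components using (transpose; transpose-inverse)
  open import Data.Vec as Vec using (Vec; []; _∷_; lookup; tabulate)
  open import Data.Vec.Properties
    using (tabulate-cong; lookup∘tabulate; tabulate∘lookup; ≡-dec; ∷-injective)
  open import Data.List using (List; []; _∷_; _++_; map; allFin; filter; filterᵇ; concatMap; foldr; cartesianProductWith)
  open import Data.List.Properties using (map-tabulate; map-∘; map-++; filter-all; concatMap-cong; concatMap-map)
  open import Data.List.Membership.Propositional using (_∈_; lose; find)
  open import Data.List.Membership.Propositional.Properties
    using (∈-map⁺; ∈-map⁻; ∈-filter⁺; ∈-filter⁻; ∈-allFin; ∈-cartesianProductWith⁺)
  open import Data.List.Membership.Propositional.Properties.WithK using (unique∧set⇒bag)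
  open import Data.List.Relation.Unary.All as All using (All; []; _∷_)
  import Data.List.Relation.Unary.All.Properties as All
  open import Data.List.Relation.Unary.Any using (here)
  open import Data.List.Relation.Unary.Any.Properties using (any⁺; any⁻)
  open import Data.List.Relation.Unary.AllPairs using ([]; _∷_)
  open import Data.List.Relation.Unary.Unique.Propositional using (Unique)
  open import Data.List.Relation.Unary.Unique.Propositional.Properties as Unique using (allFin⁺; cartesianProductWith⁺)
  open import Data.List.Relation.Binary.BagAndSetEquality using (∼bag⇒↭)
  open import Data.List.Relation.Binary.Permutation.Propositional using (_↭_)
  open import Data.Product using (∃-syntax; _×_; _,_; proj₁; proj₂; uncurry)
  open import Function using (_∘_; id; mk⇔)
  open import Function.Definitions using (Injective)
  open import Relation.Nullary using (yes; no; does; contradiction)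
  open import Relation.Nullary.Decidable using (dec-true; dec-false)
  open import Relation.Binary.PropositionalEquality as ≡ hiding (trans)
  open ≡-Reasoning

  private variable
    n : ℕ
    X Y : Set

  -- Built by the recursion of `Σswap`, first the head against the tail and then pairs within the
  -- tail, so that the two sums agree term by term.
  pairs : ∀ n → List (Fin n × Fin n)
  pairs zero    = []
  pairs (suc n) = map (λ j → zero , suc j) (allFin n) ++ map (λ (i , j) → suc i , suc j) (pairs n)

  allFin-suc : ∀ n → allFin (suc n) ≡ zero ∷ map suc (allFin n)
  allFin-suc n = cong (zero ∷_) (sym (map-tabulate id suc))

  filter-suc : ∀ (i : Fin n) (js : List (Fin n)) →
    filter (λ j → toℕ (suc i) <? toℕ j) (map suc js) ≡ map suc (filter (λ j → toℕ i <? toℕ j) js)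
  filter-suc i []       = refl
  filter-suc i (j ∷ js) with does (toℕ i <? toℕ j)
  ... | true  = cong (suc j ∷_) (filter-suc i js)
  ... | false = filter-suc i js

  concatMap-pairs : ∀ n (f : Fin n → Fin n → X) →
    concatMap (λ i → map (f i) (filter (λ j → toℕ i <? toℕ j) (allFin n))) (allFin n) ≡ map (uncurry f) (pairs n)
  concatMap-pairs zero    f = refl
  concatMap-pairs (suc n) f = begin
    concatMap row (allFin (suc n))
      ≡⟨ cong (concatMap row) (allFin-suc n) ⟩
    row zero ++ concatMap row (map suc (allFin n))
      ≡⟨ cong₂ _++_ row-zero (concatMap-map row suc (allFin n)) ⟩
    map (uncurry f) (map (λ j → zero , suc j) (allFin n)) ++ concatMap (row ∘ suc) (allFin n)
      ≡⟨ cong (map (uncurry f) (map (λ j → zero , suc j) (allFin n)) ++_)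
           (≡.trans (concatMap-cong row-suc (allFin n))
             (≡.trans (concatMap-pairs n (λ i j → f (suc i) (suc j))) (map-∘ (pairs n)))) ⟩
    map (uncurry f) (map (λ j → zero , suc j) (allFin n)) ++ map (uncurry f) (map (λ (i , j) → suc i , suc j) (pairs n))
      ≡⟨ map-++ (uncurry f) (map (λ j → zero , suc j) (allFin n)) _ ⟨
    map (uncurry f) (pairs (suc n)) ∎
    where
    row : Fin (suc n) → List _
    row i = map (f i) (filter (λ j → toℕ i <? toℕ j) (allFin (suc n)))
    row-zero : row zero ≡ map (uncurry f) (map (λ j → zero , suc j) (allFin n))
    row-zero = begin
      row zero                        ≡⟨ cong (λ js → map (f zero) (filter (λ j → 0 <? toℕ j) js)) (allFin-suc n) ⟩
      map (f zero) (filter (λ j → 0 <? toℕ j) (map suc (allFin n)))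
        ≡⟨ cong (map (f zero)) (filter-all (λ j → 0 <? toℕ j) (All.map⁺ (All.universal (λ _ → z<s) (allFin n)))) ⟩
      map (f zero) (map suc (allFin n))  ≡⟨ map-∘ (allFin n) ⟨
      map (f zero ∘ suc) (allFin n)      ≡⟨ map-∘ (allFin n) ⟩
      map (uncurry f) (map (λ j → zero , suc j) (allFin n)) ∎
    row-suc : ∀ i → row (suc i) ≡ map (f (suc i) ∘ suc) (filter (λ j → toℕ i <? toℕ j) (allFin n))
    row-suc i = begin
      row (suc i)
        ≡⟨ cong (λ js → map (f (suc i)) (filter (λ j → toℕ (suc i) <? toℕ j) js)) (allFin-suc n) ⟩
      map (f (suc i)) (filter (λ j → toℕ (suc i) <? toℕ j) (map suc (allFin n)))
        ≡⟨ cong (map (f (suc i))) (filter-suc i (allFin n)) ⟩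
      map (f (suc i)) (map suc (filter (λ j → toℕ i <? toℕ j) (allFin n)))
        ≡⟨ map-∘ _ ⟨
      map (f (suc i) ∘ suc) (filter (λ j → toℕ i <? toℕ j) (allFin n)) ∎

  Transpositions-pairs : ∀ n → Transpositions n ≡ map (uncurry transposition) (pairs n)
  Transpositions-pairs n = concatMap-pairs n transposition

  pairs-increasing : ∀ n → All (λ (i , j) → toℕ i < toℕ j) (pairs n)
  pairs-increasing zero    = []
  pairs-increasing (suc n) = All.++⁺ (All.map⁺ (All.universal (λ _ → z<s) (allFin n)))
    (All.map⁺ (All.map s<s (pairs-increasing n)))

  pairs-unique : ∀ n → Unique (pairs n)
  pairs-unique zero    = []
  pairs-unique (suc n) = Unique.++⁺ (Unique.map⁺ (λ { refl → refl }) (allFin⁺ n))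
    (Unique.map⁺ (λ { refl → refl }) (pairs-unique n)) disjoint
    where
    disjoint : ∀ {p} → p ∈ map (λ j → zero , suc j) (allFin n) ×
                       p ∈ map (λ (i , j) → suc i , suc j) (pairs n) → _
    disjoint (p∈ , p∈′) with ∈-map⁻ _ p∈ | ∈-map⁻ _ p∈′
    ... | _ , _ , refl | _ , _ , ()

  -- Injectivity is relative to `P` because a transposition determines its pair only once the pair
  -- is ordered.
  map-unique : ∀ {P : X → Set} {f : X → Y} {xs} → (∀ {x y} → P x → P y → f x ≡ f y → x ≡ y) →
               All P xs → Unique xs → Unique (map f xs)
  map-unique inj []         []            = []
  map-unique inj (px ∷ pxs) (x≢xs ∷ uniq) =
    All.map⁺ (All.zipWith (λ (x≢y , py) → x≢y ∘ inj px py) (x≢xs , pxs)) ∷ map-unique inj pxs uniq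

  Σℤ : (X → ℤ) → List X → ℤ
  Σℤ h xs = foldr (λ x s → h x + s) 0ℤ xs

  Σℤ-cong : ∀ {h h′ : X → ℤ} → (∀ x → h x ≡ h′ x) → ∀ xs → Σℤ h xs ≡ Σℤ h′ xs
  Σℤ-cong eq []       = refl
  Σℤ-cong eq (x ∷ xs) = cong₂ _+_ (eq x) (Σℤ-cong eq xs)

  Σℤ-map : ∀ (h : Y → ℤ) (f : X → Y) xs → Σℤ h (map f xs) ≡ Σℤ (h ∘ f) xs
  Σℤ-map h f []       = refl
  Σℤ-map h f (x ∷ xs) = cong (λ s → h (f x) + s) (Σℤ-map h f xs)

  Σℤ-++ : ∀ (h : X → ℤ) xs ys → Σℤ h (xs ++ ys) ≡ Σℤ h xs + Σℤ h ys
  Σℤ-++ h []       ys = sym (+-identityˡ _)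
  Σℤ-++ h (x ∷ xs) ys = ≡.trans (cong (λ s → h x + s) (Σℤ-++ h xs ys)) (sym (+-assoc (h x) _ _))

  transpose-suc : ∀ (i j k : Fin n) → transpose (suc i) (suc j) (suc k) ≡ suc (transpose i j k)
  transpose-suc i j k with does (k ≟ i)
  ... | true = refl
  ... | false with does (k ≟ j)
  ...   | true  = refl
  ...   | false = refl

  transpose-zero : ∀ (w : Fin (suc n) → ℤ) (j k : Fin n) →
    w (transpose zero (suc j) (suc k)) ≡ (if does (k ≟ j) then w zero else w (suc k))
  transpose-zero w j k with does (k ≟ j)
  ... | true  = refl
  ... | false = refl

  Σexchange-tabulate : ∀ n b (w : Fin n → ℤ) Ψ → Σexchange b (tabulate w) Ψ ≡
    Σℤ (λ j → Ψ (w j) (tabulate (λ k → if does (k ≟ j) then b else w k))) (allFin n)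
  Σexchange-tabulate zero    b w Ψ = refl
  Σexchange-tabulate (suc n) b w Ψ = begin
    Ψ (w zero) (b ∷ tabulate (w ∘ suc)) + Σexchange b (tabulate (w ∘ suc)) (λ c u → Ψ c (w zero ∷ u))
      ≡⟨ cong (λ s → Ψ (w zero) (b ∷ tabulate (w ∘ suc)) + s)
           (≡.trans (Σexchange-tabulate n b (w ∘ suc) _) (sym (Σℤ-map summand suc (allFin n)))) ⟩
    summand zero + Σℤ summand (map suc (allFin n))
      ≡⟨ cong (Σℤ summand) (allFin-suc n) ⟨
    Σℤ summand (allFin (suc n)) ∎
    where
    summand : Fin (suc n) → ℤ
    summand j = Ψ (w j) (tabulate (λ k → if does (k ≟ j) then b else w k))

  Σswap-tabulate : ∀ n (w : Fin n → ℤ) Φ →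
    Σℤ (λ (i , j) → Φ (tabulate (w ∘ transpose i j))) (pairs n) ≡ Σswap (tabulate w) Φ
  Σswap-tabulate zero    w Φ = refl
  Σswap-tabulate (suc n) w Φ = begin
    Σℤ summand (pairs (suc n))
      ≡⟨ Σℤ-++ summand (map (λ j → zero , suc j) (allFin n)) _ ⟩
    Σℤ summand (map (λ j → zero , suc j) (allFin n)) + Σℤ summand (map (λ (i , j) → suc i , suc j) (pairs n))
      ≡⟨ cong₂ _+_ (Σℤ-map summand _ (allFin n)) (Σℤ-map summand _ (pairs n)) ⟩
    Σℤ (λ j → summand (zero , suc j)) (allFin n) + Σℤ (λ (i , j) → summand (suc i , suc j)) (pairs n)
      ≡⟨ cong₂ _+_
           (Σℤ-cong (λ j → cong (λ u → Φ (w (suc j) ∷ u)) (tabulate-cong (transpose-zero w j))) (allFin n))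
           (Σℤ-cong (λ (i , j) → cong (λ u → Φ (w zero ∷ u)) (tabulate-cong (cong w ∘ transpose-suc i j))) (pairs n)) ⟩
    Σℤ (λ j → Φ (w (suc j) ∷ tabulate (λ k → if does (k ≟ j) then w zero else w (suc k)))) (allFin n) +
    Σℤ (λ (i , j) → Φ (w zero ∷ tabulate (w ∘ suc ∘ transpose i j))) (pairs n)
      ≡⟨ cong₂ _+_ (sym (Σexchange-tabulate n (w zero) (w ∘ suc) _)) (Σswap-tabulate n (w ∘ suc) _) ⟩
    Σswap (tabulate w) Φ ∎
    where
    summand : Fin (suc n) × Fin (suc n) → ℤ
    summand (i , j) = Φ (tabulate (w ∘ transpose i j))

  -- Pigeonhole: if `y` were missed, punching it out would inject `Fin (suc n)` into `Fin n`.
  injective⇒surjective : ∀ {f : Fin n → Fin n} → Injective _≡_ _≡_ f → ∀ y → ∃[ x ] f x ≡ y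
  injective⇒surjective {suc n} {f} inj y with any? (λ x → f x ≟ y)
  ... | yes hit  = hit
  ... | no  miss = contradiction
    (injective⇒≤ {f = λ x → punchOut (y≢f x)} (λ {x} {x′} eq → inj (punchOut-injective (y≢f x) (y≢f x′) eq)))
    (n≮n n)
    where
    y≢f : ∀ x → y ≢ f x
    y≢f x y≡fx = miss (x , sym y≡fx)

  transpose-involutive : ∀ (i j k : Fin n) → transpose i j (transpose i j k) ≡ k
  transpose-involutive i j k = ≡.trans (cong (transpose i j) (transpose-comm i j k)) (transpose-inverse i j)
    where
    transpose-comm : ∀ (i j k : Fin n) → transpose i j k ≡ transpose j i k
    transpose-comm i j k with k ≟ i | k ≟ j
    ... | yes refl | yes refl = refl
    ... | yes refl | no  _    rewrite dec-true (k ≟ k) refl = refl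
    ... | no  _    | yes refl rewrite dec-true (k ≟ k) refl = refl
    ... | no  k≢i  | no  k≢j  rewrite dec-false (k ≟ i) k≢i | dec-false (k ≟ j) k≢j = refl

  -- Evaluate at `i`, which the left side sends to `j`. The right side gives `j′` if `i` is `i′`; it
  -- gives `i′` if `i` is `j′`, against the two orderings; otherwise it fixes `i`, against `i < j`.
  transpose-injective : ∀ {i j i′ j′ : Fin n} → toℕ i < toℕ j → toℕ i′ < toℕ j′ →
    (∀ k → transpose i j k ≡ transpose i′ j′ k) → (i , j) ≡ (i′ , j′)
  transpose-injective {i = i} {j} {i′} {j′} i<j i′<j′ eq with i ≟ i′ | i ≟ j′ | eq i
  ... | yes refl | _        | eqᵢ rewrite dec-true (i ≟ i) refl = cong (i ,_) eqᵢ
  ... | no  i≢i′ | yes refl | eqᵢ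
    rewrite dec-true (i ≟ i) refl | eqᵢ = contradiction i′<j′ (<-asym i<j)
  ... | no  i≢i′ | no i≢j′  | eqᵢ
    rewrite dec-true (i ≟ i) refl | dec-false (i ≟ j′) i≢j′ | eqᵢ = contradiction i<j (n≮n _)

  lookup-transposition : ∀ (i j : Fin n) f k →
    lookup (transposition i j ∘ₚ f) k ≡ transpose i j (lookup f k)
  lookup-transposition i j f k =
    ≡.trans (lookup∘tabulate _ k) (lookup∘tabulate (transpose i j) (lookup f k))

  lookup-ext : ∀ {f g : Vec X n} → (∀ k → lookup f k ≡ lookup g k) → f ≡ g
  lookup-ext {f = f} {g} eq = begin
    f                   ≡⟨ tabulate∘lookup f ⟨
    tabulate (lookup f) ≡⟨ tabulate-cong eq ⟩
    tabulate (lookup g) ≡⟨ tabulate∘lookup g ⟩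
    g                   ∎

  transposition-involutive : ∀ (i j : Fin n) f → transposition i j ∘ₚ (transposition i j ∘ₚ f) ≡ f
  transposition-involutive i j f = lookup-ext λ k → begin
    lookup (transposition i j ∘ₚ (transposition i j ∘ₚ f)) k ≡⟨ lookup-transposition i j (transposition i j ∘ₚ f) k ⟩
    transpose i j (lookup (transposition i j ∘ₚ f) k)        ≡⟨ cong (transpose i j) (lookup-transposition i j f k) ⟩
    transpose i j (transpose i j (lookup f k))               ≡⟨ transpose-involutive i j _ ⟩
    lookup f k                                               ∎

  transposition-IsPerm : ∀ (i j : Fin n) f → IsPerm f → IsPerm (transposition i j ∘ₚ f)
  transposition-IsPerm i j f perm k l eq = perm k l (begin
    lookup f k                                  ≡⟨ transpose-involutive i j _ ⟨
    transpose i j (transpose i j (lookup f k))  ≡⟨ cong (transpose i j) transposed ⟩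
    transpose i j (transpose i j (lookup f l))  ≡⟨ transpose-involutive i j _ ⟩
    lookup f l                                  ∎)
    where
    transposed : transpose i j (lookup f k) ≡ transpose i j (lookup f l)
    transposed = ≡.trans (sym (lookup-transposition i j f k)) (≡.trans eq (lookup-transposition i j f l))

  -- The enumeration of the symmetric group and the neighbours of a permutation.

  allVecs-product : ∀ n k → allVecs n (suc k) ≡ cartesianProductWith _∷_ (allFin n) (allVecs n k)
  allVecs-product n k = go (allFin n)
    where
    go : ∀ xs → concatMap (λ x → map (x ∷_) (allVecs n k)) xs ≡ cartesianProductWith _∷_ xs (allVecs n k)
    go []       = refl
    go (x ∷ xs) = cong (map (x ∷_) (allVecs n k) ++_) (go xs)

  allVecs-unique : ∀ n k → Unique (allVecs n k)
  allVecs-unique n zero    = [] ∷ []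
  allVecs-unique n (suc k) = subst Unique (sym (allVecs-product n k))
    (cartesianProductWith⁺ _∷_ ∷-injective (allFin⁺ n) (allVecs-unique n k))

  ∈-allVecs : ∀ {k} (v : Vec (Fin n) k) → v ∈ allVecs n k
  ∈-allVecs []                = here refl
  ∈-allVecs {n} {suc k} (x ∷ v) = subst (_ ∈_) (sym (allVecs-product n k))
    (∈-cartesianProductWith⁺ _∷_ (∈-allFin x) (∈-allVecs v))

  Sym-unique : ∀ n → Unique (Sym n)
  Sym-unique n = Unique.filter⁺ isPerm? (allVecs-unique n n)

  ∈-Sym : ∀ (f : Vec (Fin n) n) → IsPerm f → f ∈ Sym n
  ∈-Sym f perm = ∈-filter⁺ isPerm? (∈-allVecs f) perm

  neighbours : Vec (Fin n) n → List (Vec (Fin n) n)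
  neighbours {n} f = map (λ (i , j) → transposition i j ∘ₚ f) (pairs n)

  neighbours-unique : ∀ (f : Vec (Fin n) n) → IsPerm f → Unique (neighbours f)
  neighbours-unique {n} f perm = map-unique inj (pairs-increasing n) (pairs-unique n)
    where
    inj : ∀ {p q : Fin n × Fin n} → toℕ (proj₁ p) < toℕ (proj₂ p) → toℕ (proj₁ q) < toℕ (proj₂ q) →
          uncurry transposition p ∘ₚ f ≡ uncurry transposition q ∘ₚ f → p ≡ q
    inj {i , j} {i′ , j′} lt lt′ eq = transpose-injective lt lt′ λ k →
      let (x , fx≡k) = injective⇒surjective (perm _ _) k in begin
        transpose i j k                      ≡⟨ cong (transpose i j) fx≡k ⟨
        transpose i j (lookup f x)           ≡⟨ lookup-transposition i j f x ⟨
        lookup (transposition i j ∘ₚ f) x    ≡⟨ cong (λ g → lookup g x) eq ⟩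
        lookup (transposition i′ j′ ∘ₚ f) x  ≡⟨ lookup-transposition i′ j′ f x ⟩
        transpose i′ j′ (lookup f x)         ≡⟨ cong (transpose i′ j′) fx≡k ⟩
        transpose i′ j′ k                    ∎

  -- A transposition is its own inverse, so `f = t ∘ₚ g` gives `g = t ∘ₚ f`.
  adjacent⇒neighbour : ∀ (f g : Vec (Fin n) n) → T (adjacentᵇ f g) → g ∈ neighbours f
  adjacent⇒neighbour {n} f g adjacent
    with find (any⁻ (λ t → does (≡-dec _≟_ f (t ∘ₚ g))) (Transpositions n) adjacent)
  ... | t , t∈ , holds with ∈-map⁻ _ (subst (t ∈_) (Transpositions-pairs n) t∈)
  ... | (i , j) , p∈ , refl with ≡-dec _≟_ f (transposition i j ∘ₚ g)
  ... | yes refl = subst (_∈ neighbours f) (transposition-involutive i j g) (∈-map⁺ _ p∈)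

  neighbour⇒adjacent : ∀ (f g : Vec (Fin n) n) → g ∈ neighbours f → T (adjacentᵇ f g)
  neighbour⇒adjacent {n} f g g∈ with ∈-map⁻ _ g∈
  ... | (i , j) , p∈ , refl = any⁺ (λ t → does (≡-dec _≟_ f (t ∘ₚ g)))
    (lose (subst (transposition i j ∈_) (sym (Transpositions-pairs n)) (∈-map⁺ (uncurry transposition) p∈))
          (subst T (sym (dec-true (≡-dec _≟_ f _) (sym (transposition-involutive i j f)))) _))

  -- The matrix entries are 0 or 1 and ignore multiplicity. Both lists are free of duplicates and
  -- have the same members, so a row sum of the matrix is a sum over ordered pairs.
  adjacent-↭ : ∀ (f : Vec (Fin n) n) → IsPerm f → filterᵇ (adjacentᵇ f) (Sym n) ↭ neighbours f
  adjacent-↭ {n} f perm = ∼bag⇒↭ (unique∧set⇒bag (Unique.filter⁺ _ (Sym-unique n)) (neighbours-unique f perm)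
    (mk⇔ (λ g∈ → adjacent⇒neighbour f _ (proj₂ (∈-filter⁻ _ {xs = Sym n} g∈)))
         (λ g∈ → ∈-filter⁺ _ (∈-Sym _ (neighbour-IsPerm g∈)) (neighbour⇒adjacent f _ g∈))))
    where
    neighbour-IsPerm : ∀ {g : Vec (Fin n) n} → g ∈ neighbours f → IsPerm g
    neighbour-IsPerm g∈ with ∈-map⁻ _ g∈
    ... | (i , j) , _ , refl = transposition-IsPerm i j f perm

-- The rational eigenvector attached to a diagram.

module Eigenvectors where
  open Exchanges
  open Transposed
  open import Data.Integer as ℤ using (ℤ; +_; 0ℤ; 1ℤ; _+_; _*_; _-_)
  open import Data.Integer.Properties using (*-identityʳ; +-injective; i*j≡0⇒i≡0∨j≡0; i-j≡0⇒i≡j)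
  open import Data.Rational as ℚ using (ℚ; 0ℚ; 1ℚ; toℚᵘ)
  import Data.Rational.Properties as ℚ
  open import Data.Rational.Unnormalised as ℚᵘ using (mkℚᵘ; *≡*)
  import Data.Rational.Unnormalised.Properties as ℚᵘ
  open import Data.Nat.ListAction using (sum)
  open import Data.Nat.Properties using (suc-injective)
  open import Data.Bool using (Bool; true; false; if_then_else_)
  open import Data.Fin using (Fin)
  open import Data.Fin.Properties using (_≟_)
  open import Data.Fin.Permutation.Components using (transpose)
  open import Data.Vec as Vec using (Vec; []; _∷_; lookup; tabulate; take)
  open import Data.Vec.Properties using (tabulate-cong; tabulate-∘; lookup∘tabulate; tabulate∘lookup)
  open import Data.Vec.Membership.Propositional using (_∈_)
  open import Data.Vec.Membership.Propositional.Properties using (∈-allFin⁺)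
  open import Data.Vec.Relation.Unary.All using (All; []; _∷_)
  open import Data.Vec.Relation.Unary.Any using (here; there)
  open import Data.Vec.Relation.Unary.AllPairs using ([]; _∷_)
  open import Data.Vec.Relation.Unary.Unique.Propositional using (Unique)
  open import Data.Vec.Relation.Unary.Unique.Propositional.Properties using (take⁺; drop⁺; tabulate⁺)
  open import Data.List using (List; []; _∷_; map; filterᵇ)
  import Data.List.Membership.Propositional
  open import Data.List.Membership.Propositional.Properties using (∈-filter⁻)
  open import Data.List.Relation.Binary.Permutation.Propositional using (_↭_; refl; prep; swap; trans)
  open import Data.Product using (_,_; proj₂)
  open import Data.Sum using ([_,_]′)
  open import Function using (_∘_; id)
  open import Relation.Nullary using (yes; no; does; contradiction)
  open import Relation.Binary.PropositionalEquality as ≡ hiding (trans)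
  open ≡-Reasoning

  private variable
    n : ℕ
    X Y : Set

  fromℤ : ℤ → ℚ
  fromℤ i = i ℚ./ 1

  -- The fraction `i / 1` hides a gcd normalisation; on unnormalised rationals only numerators
  -- remain to be compared.
  fromℤ-+ : ∀ i j → fromℤ (i + j) ≡ fromℤ i ℚ.+ fromℤ j
  fromℤ-+ i j = ℚ.toℚᵘ-injective (begin′
    toℚᵘ (fromℤ (i + j))                   ≈⟨ ℚ.toℚᵘ-fromℚᵘ (mkℚᵘ (i + j) 0) ⟩
    mkℚᵘ (i + j) 0                         ≈⟨ *≡* (cong (_* 1ℤ) (cong₂ _+_ (*-identityʳ i) (*-identityʳ j))) ⟨
    mkℚᵘ i 0 ℚᵘ.+ mkℚᵘ j 0                 ≈⟨ ℚᵘ.+-cong (ℚ.toℚᵘ-fromℚᵘ (mkℚᵘ i 0)) (ℚ.toℚᵘ-fromℚᵘ (mkℚᵘ j 0)) ⟨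
    toℚᵘ (fromℤ i) ℚᵘ.+ toℚᵘ (fromℤ j)     ≈⟨ ℚ.toℚᵘ-homo-+ (fromℤ i) (fromℤ j) ⟨
    toℚᵘ (fromℤ i ℚ.+ fromℤ j)             ∎′)
    where open ℚᵘ.≃-Reasoning renaming (begin_ to begin′_; _∎ to _∎′)

  fromℤ-* : ∀ i j → fromℤ (i * j) ≡ fromℤ i ℚ.* fromℤ j
  fromℤ-* i j = ℚ.toℚᵘ-injective (begin′
    toℚᵘ (fromℤ (i * j))                   ≈⟨ ℚ.toℚᵘ-fromℚᵘ (mkℚᵘ (i * j) 0) ⟩
    mkℚᵘ i 0 ℚᵘ.* mkℚᵘ j 0                 ≈⟨ ℚᵘ.*-cong (ℚ.toℚᵘ-fromℚᵘ (mkℚᵘ i 0)) (ℚ.toℚᵘ-fromℚᵘ (mkℚᵘ j 0)) ⟨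
    toℚᵘ (fromℤ i) ℚᵘ.* toℚᵘ (fromℤ j)     ≈⟨ ℚ.toℚᵘ-homo-* (fromℤ i) (fromℤ j) ⟨
    toℚᵘ (fromℤ i ℚ.* fromℤ j)             ∎′)
    where open ℚᵘ.≃-Reasoning renaming (begin_ to begin′_; _∎ to _∎′)

  fromℤ-≢0 : ∀ {i} → i ≢ 0ℤ → fromℤ i ≢ 0ℚ
  fromℤ-≢0 {i} i≢0 eq with ℚᵘ.≃-trans (ℚᵘ.≃-sym (ℚ.toℚᵘ-fromℚᵘ (mkℚᵘ i 0))) (ℚᵘ.≃-reflexive (cong toℚᵘ eq))
  ... | *≡* i*1≡0 = i≢0 (≡.trans (sym (*-identityʳ i)) i*1≡0)

  sumℚ-fromℤ : ∀ (h : X → ℤ) xs → sumℚ (fromℤ ∘ h) xs ≡ fromℤ (Σℤ h xs)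
  sumℚ-fromℤ h []       = refl
  sumℚ-fromℤ h (x ∷ xs) = ≡.trans (cong (fromℤ (h x) ℚ.+_) (sumℚ-fromℤ h xs)) (sym (fromℤ-+ (h x) (Σℤ h xs)))

  sumℚ-↭ : ∀ (h : X → ℚ) {xs ys} → xs ↭ ys → sumℚ h xs ≡ sumℚ h ys
  sumℚ-↭ h refl        = refl
  sumℚ-↭ h (prep x p)  = cong (h x ℚ.+_) (sumℚ-↭ h p)
  sumℚ-↭ h (swap {xs} {ys} x y p) = begin
    h x ℚ.+ (h y ℚ.+ sumℚ h xs)  ≡⟨ ℚ.+-assoc (h x) (h y) _ ⟨
    (h x ℚ.+ h y) ℚ.+ sumℚ h xs  ≡⟨ cong₂ ℚ._+_ (ℚ.+-comm (h x) (h y)) (sumℚ-↭ h p) ⟩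
    (h y ℚ.+ h x) ℚ.+ sumℚ h ys  ≡⟨ ℚ.+-assoc (h y) (h x) _ ⟩
    h y ℚ.+ (h x ℚ.+ sumℚ h ys)  ∎
  sumℚ-↭ h (trans p q) = ≡.trans (sumℚ-↭ h p) (sumℚ-↭ h q)

  sumℚ-indicator : ∀ (p : X → Bool) (h : X → ℚ) xs →
    sumℚ (λ x → (if p x then 1ℚ else 0ℚ) ℚ.* h x) xs ≡ sumℚ h (filterᵇ p xs)
  sumℚ-indicator p h []       = refl
  sumℚ-indicator p h (x ∷ xs) with p x
  ... | true  = cong₂ ℚ._+_ (ℚ.*-identityˡ (h x)) (sumℚ-indicator p h xs)
  ... | false = ≡.trans (cong₂ ℚ._+_ (ℚ.*-zeroˡ (h x)) (sumℚ-indicator p h xs)) (ℚ.+-identityˡ _)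

  sumℚ-map : ∀ (h : Y → ℚ) (f : X → Y) xs → sumℚ h (map f xs) ≡ sumℚ (h ∘ f) xs
  sumℚ-map h f []       = refl
  sumℚ-map h f (x ∷ xs) = cong (h (f x) ℚ.+_) (sumℚ-map h f xs)

  -- the index of the first occurrence, or the length if there is none
  position : ∀ {k} → Vec (Fin n) k → Fin n → ℕ
  position []      i = 0
  position (x ∷ f) i = if does (x ≟ i) then 0 else suc (position f i)

  position-map : ∀ {k} (τ : Fin n → Fin n) → (∀ i → τ (τ i) ≡ i) → ∀ (f : Vec (Fin n) k) i →
                 position (Vec.map τ f) i ≡ position f (τ i)
  position-map τ invol []      i = refl
  position-map τ invol (x ∷ f) i with τ x ≟ i | x ≟ τ i
  ... | yes _    | yes _    = refl
  ... | yes refl | no  x≢   = contradiction (sym (invol x)) x≢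
  ... | no  τx≢  | yes refl = contradiction (invol i) τx≢
  ... | no  _    | no  _    = cong suc (position-map τ invol f i)

  position-injective : ∀ {k} {f : Vec (Fin n) k} {i j} → i ∈ f → j ∈ f → position f i ≡ position f j → i ≡ j
  position-injective {f = x ∷ f} {i} {j} i∈ j∈ eq with x ≟ i | x ≟ j
  position-injective i∈         j∈         eq | yes refl | yes refl = refl
  position-injective (here refl) j∈         eq | no x≢i | no _ = contradiction refl x≢i
  position-injective (there i∈) (here refl) eq | no _ | no x≢j = contradiction refl x≢j
  position-injective (there i∈) (there j∈) eq | no _ | no _ = position-injective i∈ j∈ (suc-injective eq)

  positions : Vec (Fin n) n → Fin n → ℤ
  positions g i = + position g i

  -- The positions of a permutation form its inverse, and inversion turns left multiplication by a
  -- transposition into exchanging two entries. This is why the Specht polynomial is evaluated at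
  -- positions rather than at values.
  positions-transposition : ∀ (i j : Fin n) g k →
    positions (transposition i j ∘ₚ g) k ≡ positions g (transpose i j k)
  positions-transposition i j g k = cong +_ (begin
    position (transposition i j ∘ₚ g) k            ≡⟨ cong (λ f → position f k) as-map ⟩
    position (Vec.map (transpose i j) g) k         ≡⟨ position-map (transpose i j) (transpose-involutive i j) g k ⟩
    position g (transpose i j k)                   ∎)
    where
    as-map : transposition i j ∘ₚ g ≡ Vec.map (transpose i j) g
    as-map = begin
      tabulate (λ x → lookup (transposition i j) (lookup g x)) ≡⟨ tabulate-cong (λ x → lookup∘tabulate _ (lookup g x)) ⟩
      tabulate (transpose i j ∘ lookup g)                      ≡⟨ tabulate-∘ (transpose i j) (lookup g) ⟩
      Vec.map (transpose i j) (tabulate (lookup g))            ≡⟨ cong (Vec.map (transpose i j)) (tabulate∘lookup g) ⟩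
      Vec.map (transpose i j) g                                ∎

  ∏diff-≢0 : ∀ {a} {u : Vec ℤ n} → All (a ≢_) u → ∏diff a u ≢ 0ℤ
  ∏diff-≢0 {a = a} {c ∷ u} (a≢c ∷ a≢u) eq =
    [ a≢c ∘ i-j≡0⇒i≡j a c , ∏diff-≢0 a≢u ]′ (i*j≡0⇒i≡0∨j≡0 (a - c) eq)

  vandermonde-≢0 : ∀ {u : Vec ℤ n} → Unique u → vandermonde u ≢ 0ℤ
  vandermonde-≢0 {u = a ∷ u} (a≢u ∷ uniq) eq =
    [ ∏diff-≢0 a≢u , vandermonde-≢0 uniq ]′ (i*j≡0⇒i≡0∨j≡0 (∏diff a u) eq)

  specht-≢0 : ∀ hs {w} → Unique w → specht hs w ≢ 0ℤ
  specht-≢0 (h ∷ hs) {w} uniq eq =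
    [ vandermonde-≢0 (take⁺ h uniq) , specht-≢0 hs (drop⁺ h uniq) ]′
      (i*j≡0⇒i≡0∨j≡0 (vandermonde (take h w)) eq)

  content-eigenvalue : ∀ {hs} → Descending hs → IsCayEigenvalue (sum hs) (fromℤ (content hs))
  content-eigenvalue {hs} desc = v , (identity , ∈-Sym identity identity-IsPerm , nonzero) , eigen
    where
    m = sum hs
    F : Vec (Fin m) m → ℤ
    F g = specht hs (tabulate (positions g))
    v : Vec (Fin m) m → ℚ
    v = fromℤ ∘ F
    identity : Vec (Fin m) m
    identity = Vec.allFin m
    identity-IsPerm : IsPerm identity
    identity-IsPerm i j eq = ≡.trans (sym (lookup∘tabulate id i)) (≡.trans eq (lookup∘tabulate id j))
    nonzero : v identity ≢ 0ℚ
    -- The positions are pairwise distinct, so no Vandermonde factor vanishes.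
    nonzero = fromℤ-≢0 (specht-≢0 hs (tabulate⁺ λ {i} {j} eq →
      position-injective (∈-allFin⁺ i) (∈-allFin⁺ j) (+-injective eq)))
    eigen : ∀ f → f Data.List.Membership.Propositional.∈ Sym m →
            sumℚ (λ g → adj f g ℚ.* v g) (Sym m) ≡ fromℤ (content hs) ℚ.* v f
    eigen f f∈ = begin
      sumℚ (λ g → adj f g ℚ.* v g) (Sym m)
        ≡⟨ sumℚ-indicator (adjacentᵇ f) v (Sym m) ⟩
      sumℚ v (filterᵇ (adjacentᵇ f) (Sym m))
        ≡⟨ sumℚ-↭ v (adjacent-↭ f (proj₂ (∈-filter⁻ isPerm? {xs = allVecs m m} f∈))) ⟩
      sumℚ v (neighbours f)
        ≡⟨ sumℚ-map v _ (pairs m) ⟩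
      sumℚ (λ (i , j) → fromℤ (F (transposition i j ∘ₚ f))) (pairs m)
        ≡⟨ sumℚ-fromℤ (λ (i , j) → F (transposition i j ∘ₚ f)) (pairs m) ⟩
      fromℤ (Σℤ (λ (i , j) → F (transposition i j ∘ₚ f)) (pairs m))
        ≡⟨ cong fromℤ (Σℤ-cong (λ (i , j) → cong (specht hs) (tabulate-cong (positions-transposition i j f))) (pairs m)) ⟩
      fromℤ (Σℤ (λ (i , j) → specht hs (tabulate (positions f ∘ transpose i j))) (pairs m))
        ≡⟨ cong fromℤ (Σswap-tabulate m (positions f) (specht hs)) ⟩
      fromℤ (Σswap (tabulate (positions f)) (specht hs))
        ≡⟨ cong fromℤ (Σswap-specht desc _) ⟩
      fromℤ (content hs * F f)
        ≡⟨ fromℤ-* (content hs) (F f) ⟩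
      fromℤ (content hs) ℚ.* v f ∎

-- Diagrams built from nested hooks around a core.

module Diagrams where
  open Exchanges using (triangle; content; Descending; []; _∷_)
  open import Data.Nat using (_≤_; _+_; _*_; z≤n; s≤s; _≤?_; _≟_)
  open import Data.Nat.Properties
  open import Data.Nat.ListAction using (sum)
  open import Data.Nat.ListAction.Properties using (sum-++)
  open import Data.Nat.Tactic.RingSolver using (solve-∀)
  open import Data.Integer as ℤ using (ℤ; +_; 0ℤ)
  import Data.Integer.Properties as ℤ
  import Data.Integer.Tactic.RingSolver as ℤ-Solver
  open import Algebra.Properties.AbelianGroup ℤ.+-0-abelianGroup using () renaming (∙-cancelˡ to +-cancelˡ; ∙-cancelʳ to +-cancelʳ)
  open import Data.List using (List; []; _∷_; _++_; map; length; replicate)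
  open import Data.List.Properties using (length-map; length-++; length-replicate)
  open import Data.List.Relation.Unary.All as All using (All; []; _∷_; all?)
  import Data.List.Relation.Unary.All.Properties as All
  open import Data.Product using (_,_)
  open import Relation.Nullary using (Dec; yes)
  open import Relation.Nullary.Decidable using (True; toWitness; map′; _×-dec_)
  open import Relation.Binary.PropositionalEquality
  open ≡-Reasoning

  -- A diagram inside the rectangle with r columns and s rows, consisting of n
  -- boxes whose contents sum to p - q; columns may be empty.
  record Diagram (r s n p q : ℕ) : Set where
    constructor diagram
    field
      columns       : List ℕ
      length≡       : length columns ≡ r
      bounded       : All (_≤ s) columns
      descending    : Descending columns
      sum≡          : sum columns ≡ n
      content≡      : content columns ℤ.+ + q ≡ + p

  sum-zeros : ∀ m → sum (replicate m 0) ≡ 0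
  sum-zeros zero    = refl
  sum-zeros (suc m) = sum-zeros m

  content-zeros : ∀ m → content (replicate m 0) ≡ 0ℤ
  content-zeros zero    = refl
  content-zeros (suc m) rewrite sum-zeros m | content-zeros m = refl

  Descending-zeros : ∀ m → Descending (replicate m 0)
  Descending-zeros zero    = []
  Descending-zeros (suc m) = All.replicate⁺ m ≤-refl ∷ Descending-zeros m

  sum-pad : ∀ hs m → sum (hs ++ replicate m 0) ≡ sum hs
  sum-pad hs m = trans (sum-++ hs (replicate m 0)) (trans (cong (λ m → sum hs + m) (sum-zeros m)) (+-identityʳ _))

  content-pad : ∀ hs m → content (hs ++ replicate m 0) ≡ content hs
  content-pad []       m = content-zeros m
  content-pad (h ∷ hs) m = cong₂ (λ s c → (+ s ℤ.- + triangle h) ℤ.+ c) (sum-pad hs m) (content-pad hs m)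

  Descending-pad : ∀ {hs} m → Descending hs → Descending (hs ++ replicate m 0)
  Descending-pad m []           = Descending-zeros m
  Descending-pad m (les ∷ desc) = All.++⁺ les (All.replicate⁺ m z≤n) ∷ Descending-pad m desc

  -- The number of columns is recorded exactly, since `surround` reads off its arm length from it;
  -- surplus width becomes empty columns.
  enlarge : ∀ {r s r′ s′ n p q} → r ≤ r′ → s ≤ s′ → Diagram r s n p q → Diagram r′ s′ n p q
  enlarge {r} r≤r′ s≤s′ (diagram hs len bd desc sm ct) with m≤n⇒∃[o]m+o≡n r≤r′
  ... | m , refl = diagram (hs ++ replicate m 0)
    (trans (length-++ hs) (cong₂ _+_ len (length-replicate m)))
    (All.++⁺ (All.map (λ le → ≤-trans le s≤s′) bd) (All.replicate⁺ m z≤n))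
    (Descending-pad m desc)
    (trans (sum-pad hs m) sm)
    (trans (cong (λ c → c ℤ.+ _) (content-pad hs m)) ct)

  sum-map-suc : ∀ hs → sum (map suc hs) ≡ length hs + sum hs
  sum-map-suc []       = refl
  sum-map-suc (h ∷ hs) = trans (cong (λ m → suc h + m) (sum-map-suc hs)) (lemma h (length hs) (sum hs))
    where
    lemma : ∀ h l s → suc h + (l + s) ≡ suc l + (h + s)
    lemma = solve-∀

  -- A new top row pushes every old box one row down, which costs 1 per box, and itself has contents
  -- `0, 1, …` up to one less than its length.
  content-map-suc : ∀ hs → content (map suc hs) ℤ.+ + sum hs ≡ content hs ℤ.+ + triangle (length hs)
  content-map-suc []       = refl
  content-map-suc (h ∷ hs) = begin
    ((+ sum (map suc hs) ℤ.- + (h + triangle h)) ℤ.+ content (map suc hs)) ℤ.+ + (h + sum hs)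
      ≡⟨ cong (λ s → ((+ s ℤ.- + (h + triangle h)) ℤ.+ content (map suc hs)) ℤ.+ + (h + sum hs)) (sum-map-suc hs) ⟩
    ((+ (length hs + sum hs) ℤ.- + (h + triangle h)) ℤ.+ content (map suc hs)) ℤ.+ + (h + sum hs)
      ≡⟨ lemma₁ (+ length hs) (+ sum hs) (+ h) (+ triangle h) (content (map suc hs)) ⟩
    ((+ sum hs ℤ.- + triangle h) ℤ.+ + length hs) ℤ.+ (content (map suc hs) ℤ.+ + sum hs)
      ≡⟨ cong (λ x → ((+ sum hs ℤ.- + triangle h) ℤ.+ + length hs) ℤ.+ x) (content-map-suc hs) ⟩
    ((+ sum hs ℤ.- + triangle h) ℤ.+ + length hs) ℤ.+ (content hs ℤ.+ + triangle (length hs))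
      ≡⟨ lemma₂ (+ sum hs ℤ.- + triangle h) (+ length hs) (content hs) (+ triangle (length hs)) ⟩
    ((+ sum hs ℤ.- + triangle h) ℤ.+ content hs) ℤ.+ + (length hs + triangle (length hs)) ∎
    where
    lemma₁ : ∀ l s h t c → (((l ℤ.+ s) ℤ.- (h ℤ.+ t)) ℤ.+ c) ℤ.+ (h ℤ.+ s) ≡ ((s ℤ.- t) ℤ.+ l) ℤ.+ (c ℤ.+ s)
    lemma₁ = ℤ-Solver.solve-∀
    lemma₂ : ∀ x l c t → (x ℤ.+ l) ℤ.+ (c ℤ.+ t) ≡ (x ℤ.+ c) ℤ.+ (l ℤ.+ t)
    lemma₂ = ℤ-Solver.solve-∀

  Descending-map-suc : ∀ {hs} → Descending hs → Descending (map suc hs)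
  Descending-map-suc []           = []
  Descending-map-suc (les ∷ desc) = All.map⁺ (All.map s≤s les) ∷ Descending-map-suc desc

  -- Old boxes move one step along their diagonals and keep their contents. The new hook adds
  -- `0 + … + r` along its arm and subtracts `0 + … + s` along its leg.
  surround : ∀ {r s n p q} → Diagram r s n p q →
    Diagram (suc r) (suc s) (suc (r + s) + n) (triangle (suc r) + p) (triangle (suc s) + q)
  surround {r} {s} {n} {p} {q} (diagram hs refl bd desc refl ct) = diagram (suc s ∷ map suc hs)
    (cong suc (length-map suc hs))
    (≤-refl ∷ bd′)
    (bd′ ∷ Descending-map-suc desc)
    (trans (cong (λ m → suc s + m) (sum-map-suc hs)) (lemma₀ s r (sum hs)))
    (begin
      ((+ sum (map suc hs) ℤ.- + T) ℤ.+ content (map suc hs)) ℤ.+ (+ T ℤ.+ + q)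
        ≡⟨ cong (λ x → ((+ x ℤ.- + T) ℤ.+ content (map suc hs)) ℤ.+ (+ T ℤ.+ + q)) (sum-map-suc hs) ⟩
      (((+ r ℤ.+ + sum hs) ℤ.- + T) ℤ.+ content (map suc hs)) ℤ.+ (+ T ℤ.+ + q)
        ≡⟨ lemma₁ (+ r) (+ sum hs) (+ T) (content (map suc hs)) (+ q) ⟩
      + r ℤ.+ ((content (map suc hs) ℤ.+ + sum hs) ℤ.+ + q)
        ≡⟨ cong (λ x → + r ℤ.+ (x ℤ.+ + q)) (content-map-suc hs) ⟩
      + r ℤ.+ ((content hs ℤ.+ + triangle r) ℤ.+ + q)
        ≡⟨ lemma₂ (+ r) (content hs) (+ triangle r) (+ q) ⟩
      (+ r ℤ.+ + triangle r) ℤ.+ (content hs ℤ.+ + q)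
        ≡⟨ cong (λ x → (+ r ℤ.+ + triangle r) ℤ.+ x) ct ⟩
      + (triangle (suc r) + p) ∎)
    where
    T = triangle (suc s)
    bd′ : All (_≤ suc s) (map suc hs)
    bd′ = All.map⁺ (All.map s≤s bd)
    lemma₀ : ∀ s r m → suc s + (r + m) ≡ suc (r + s) + m
    lemma₀ = solve-∀
    lemma₁ : ∀ r m t c q → (((r ℤ.+ m) ℤ.- t) ℤ.+ c) ℤ.+ (t ℤ.+ q) ≡ r ℤ.+ ((c ℤ.+ m) ℤ.+ q)
    lemma₁ = ℤ-Solver.solve-∀
    lemma₂ : ∀ r c t q → r ℤ.+ ((c ℤ.+ t) ℤ.+ q) ≡ (r ℤ.+ t) ℤ.+ (c ℤ.+ q)
    lemma₂ = ℤ-Solver.solve-∀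

  -- The difference is `(x + 1) + … + (x + d)`, the content sum of a hook with leg `x` and arm
  -- `x + d`.
  triangle-+ : ∀ x d → triangle (suc (x + d)) ≡ triangle (suc x) + (d * x + triangle (suc d))
  triangle-+ x zero    rewrite +-identityʳ x = sym (+-identityʳ _)
  triangle-+ x (suc d) rewrite +-suc x d = begin
    suc (x + d) + triangle (suc (x + d))
      ≡⟨ cong (λ m → suc (x + d) + m) (triangle-+ x d) ⟩
    suc (x + d) + (triangle (suc x) + (d * x + triangle (suc d)))
      ≡⟨ lemma x d (triangle (suc x)) (triangle (suc d)) ⟩
    triangle (suc x) + (suc d * x + triangle (suc (suc d))) ∎
    where
    lemma : ∀ x d t u → suc (x + d) + (t + (d * x + u)) ≡ t + (suc d * x + (suc d + u))
    lemma = solve-∀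

  Diagram-cancel : ∀ {r s n p q} t {p′} → Diagram r s n p (t + q) → p ≡ t + p′ → Diagram r s n p′ q
  Diagram-cancel {q = q} t {p′} (diagram hs len bd desc sm ct) refl = diagram hs len bd desc sm
    (+-cancelˡ (+ t) _ _ (trans (lemma (+ t) (content hs) (+ q)) ct))
    where
    lemma : ∀ t c q → t ℤ.+ (c ℤ.+ q) ≡ c ℤ.+ (t ℤ.+ q)
    lemma = ℤ-Solver.solve-∀

  -- Frobenius coordinates: the added hook has leg x and arm x + d.
  addHook : ∀ {r s n p q} d x → r ≤ x + d → s ≤ x → Diagram r s n p q →
    Diagram (suc (x + d)) (suc x) (suc (x + d + x) + n) ((d * x + triangle (suc d)) + p) q
  addHook {p = p} d x r≤ s≤ D = Diagram-cancel (triangle (suc x)) (surround (enlarge r≤ s≤ D))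
    (trans (cong (_+ p) (triangle-+ x d)) (+-assoc (triangle (suc x)) _ p))

  record HasContent (n k : ℕ) : Set where
    constructor hasContent
    field
      columns    : List ℕ
      descending : Descending columns
      sum≡       : sum columns ≡ n
      content≡   : content columns ≡ + k

  Diagram⇒HasContent : ∀ {r s n p q k n′} → Diagram r s n′ p q → n ≡ n′ → k + q ≡ p → HasContent n k
  Diagram⇒HasContent {q = q} {k} (diagram hs _ _ desc sm ct) refl refl =
    hasContent hs desc sm (+-cancelʳ (+ q) (content hs) (+ k) ct)

  Core : ℕ → ℕ → ℕ → ℕ → Set
  Core s = Diagram s s

  -- The two summands are the parts of the hook contents for `d` and `d + 1` that do not depend on
  -- the legs.
  squares : ∀ d → triangle (suc d) + triangle (suc (suc d)) ≡ suc d * suc d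
  squares zero    = refl
  squares (suc d) = trans (lemma₁ d (triangle (suc d))) (trans (cong (_+ (suc d + suc (suc d))) (squares d)) (lemma₂ d))
    where
    lemma₁ : ∀ d t → (suc d + t) + (suc (suc d) + (suc d + t)) ≡ (t + (suc d + t)) + (suc d + suc (suc d))
    lemma₁ = solve-∀
    lemma₂ : ∀ d → suc d * suc d + (suc d + suc (suc d)) ≡ suc (suc d) * suc (suc d)
    lemma₂ = solve-∀

  -- The hooks (d, 2 + y + z) and (d + 1, y) around a core.
  lower : ∀ d y z {n k s t p q} → Core s t p q → s ≤ y →
    n ≡ 2 * (2 * y + 2 + z) + (2 * d + 3) + t →
    k + q ≡ d * (2 * y + 2 + z) + y + suc d * suc d + p → HasContent n k
  lower d y z {t = t} {p} core s≤y n≡ k≡ = Diagram⇒HasContent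
    -- The inner hook occupies `y + d + 2` columns, while the outer arm exceeds the outer leg by
    -- only `d`; hence the 2 in `2 + y + z`.
    (addHook d (2 + y + z) (≤-trans (≤-reflexive (lemma₁ d y)) (≤-trans (m≤m+n (2 + y + d) z) (≤-reflexive (lemma₂ d y z)))) (m≤n⇒m≤1+n (m≤m+n (suc y) z))
      (addHook (suc d) y (≤-trans s≤y (m≤m+n y (suc d))) s≤y core))
    (trans n≡ (lemma₃ d y z t)) (trans k≡ (trans (cong (λ x → d * (2 * y + 2 + z) + y + x + p) (sym (squares d)))
      (lemma₄ d y z p (triangle (suc d)) (triangle (suc (suc d))))))
    where
    lemma₁ : ∀ d y → suc (y + suc d) ≡ 2 + y + d
    lemma₁ = solve-∀
    lemma₂ : ∀ d y z → 2 + y + d + z ≡ 2 + y + z + d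
    lemma₂ = solve-∀
    lemma₃ : ∀ d y z t → 2 * (2 * y + 2 + z) + (2 * d + 3) + t ≡
      suc (2 + y + z + d + (2 + y + z)) + (suc (y + suc d + y) + t)
    lemma₃ = solve-∀
    lemma₄ : ∀ d y z p u v → d * (2 * y + 2 + z) + y + (u + v) + p ≡
      (d * (2 + y + z) + u) + ((suc d * y + v) + p)
    lemma₄ = solve-∀

  -- The hooks (d + 1, 1 + y + z) and (d, y) around a core.
  upper : ∀ d y z {n k s t p q} → Core s t p q → s ≤ y →
    n ≡ 2 * (2 * y + 1 + z) + (2 * d + 3) + t →
    k + q ≡ d * (2 * y + 1 + z) + (y + 1 + z) + suc d * suc d + p → HasContent n k
  upper d y z {t = t} {p} core s≤y n≡ k≡ = Diagram⇒HasContent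
    -- Here the rows are the tight direction: the inner hook has `y + 1` of them, so the outer leg
    -- starts at `y + 1`.
    (addHook (suc d) (1 + y + z) (subst (suc (y + d) ≤_) (lemma₁ d y z) (m≤m+n (suc (y + d)) (suc z))) (m≤m+n (suc y) z)
      (addHook d y (≤-trans s≤y (m≤m+n y d)) s≤y core))
    (trans n≡ (lemma₃ d y z t)) (trans k≡ (trans (cong (λ x → d * (2 * y + 1 + z) + (y + 1 + z) + x + p) (sym (squares d)))
      (lemma₄ d y z p (triangle (suc d)) (triangle (suc (suc d))))))
    where
    lemma₁ : ∀ d y z → suc (y + d) + suc z ≡ 1 + y + z + suc d
    lemma₁ = solve-∀
    lemma₃ : ∀ d y z t → 2 * (2 * y + 1 + z) + (2 * d + 3) + t ≡
      suc (1 + y + z + suc d + (1 + y + z)) + (suc (y + d + y) + t)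
    lemma₃ = solve-∀
    lemma₄ : ∀ d y z p u v → d * (2 * y + 1 + z) + (y + 1 + z) + (u + v) + p ≡
      (suc d * (1 + y + z) + v) + ((d * y + u) + p)
    lemma₄ = solve-∀

  Descending? : ∀ hs → Dec (Descending hs)
  Descending? []       = yes []
  Descending? (h ∷ hs) = map′ (λ (les , desc) → les ∷ desc) (λ { (les ∷ desc) → les , desc })
    (all? (_≤? h) hs ×-dec Descending? hs)

  core : ∀ s hs {t p q} → {True (length hs ≟ s)} → {True (all? (_≤? s) hs)} → {True (Descending? hs)} →
         sum hs ≡ t → content hs ℤ.+ + q ≡ + p → Core s t p q
  core s hs {_} {_} {_} {len} {bd} {desc} = diagram hs (toWitness len) (toWitness bd) (toWitness desc)

  ∅ : Core 0 0 0 0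
  ∅ = core 0 [] refl refl

  -- Names of cores list the row lengths, whereas the lists give column heights, padded with zeros
  -- up to the side of the enclosing square.
  1-1 : Core 2 2 0 1
  1-1 = core 2 (2 ∷ 0 ∷ []) refl refl

  2-2 : Core 2 4 0 0
  2-2 = core 2 (2 ∷ 2 ∷ []) refl refl

  5-1 : Core 5 6 9 0
  5-1 = core 5 (2 ∷ 1 ∷ 1 ∷ 1 ∷ 1 ∷ []) refl refl

  □ : Core 1 1 0 0
  □ = core 1 (1 ∷ []) refl refl

  1-1-1 : Core 3 3 0 3
  1-1-1 = core 3 (3 ∷ 0 ∷ 0 ∷ []) refl refl

  2-2-1 : Core 3 5 0 2
  2-2-1 = core 3 (3 ∷ 2 ∷ 0 ∷ []) refl refl

  5-2 : Core 5 7 9 0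
  5-2 = core 5 (2 ∷ 2 ∷ 1 ∷ 1 ∷ 1 ∷ []) refl refl

-- Realising each remainder for a fixed parameter.

module Realisation where
  open Diagrams
  open import Data.Nat using (_≤_; _<_; _+_; _*_; z≤n; s≤s; _≤?_)
  open import Data.Nat.Properties
  open import Data.Nat.Tactic.RingSolver using (solve-∀)
  open import Data.Product using (∃-syntax; _×_; _,_)
  open import Data.Sum using (_⊎_; inj₁; inj₂)
  open import Relation.Nullary using (yes; no; contradiction)
  open import Relation.Binary.PropositionalEquality

  ≤-shift : ∀ {l r a b} c e → l ≤ r → a + c + e ≡ l → r ≡ b + c → a ≤ b
  ≤-shift {a = a} {b} c e l≤r refl refl = +-cancelʳ-≤ c a b (≤-trans (m≤m+n (a + c) e) l≤r)

  halve : ∀ {a b} → 2 * a ≤ suc (2 * b) → a ≤ b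
  halve {a} {b} le = ≤-pred (*-cancelˡ-< 2 a (suc b) (subst (2 * a <_) (lemma b) (s≤s le)))
    where
    lemma : ∀ b → suc (suc (2 * b)) ≡ 2 * suc b
    lemma = solve-∀

  excess : ∀ {m n} → m ≤ n → ∃[ o ] n ≡ m + o
  excess m≤n with m≤n⇒∃[o]m+o≡n m≤n
  ... | o , eq = o , sym eq

  excess-twice : ∀ {d X} e → e ≤ d → 2 * d + 13 ≤ X → ∃[ z ] X ≡ 2 * e + 13 + z
  excess-twice e e≤d le = excess (≤-trans (+-monoˡ-≤ 13 (*-monoʳ-≤ 2 e≤d)) le)

  -- Origin of the bound `2 * d + 13`. In `even-middle` the core `1-1-1` leaves the inner leg
  -- `X - y - d - 4`, which has to be at least 3. With `y` half of `X`, rounded down, this is the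
  -- hypothesis on `X`.
  centre : ∀ {d X y} → 2 * d + 13 ≤ X → 2 * y ≤ X → y + (d + 7) ≤ X
  centre {d} {X} {y} dX yX = halve (≤-shift 0 0 (s≤s (+-mono-≤ yX dX)) (lemma₁ d y) (lemma₂ X))
    where
    lemma₁ : ∀ d y → 2 * (y + (d + 7)) + 0 + 0 ≡ suc (2 * y + (2 * d + 13))
    lemma₁ = solve-∀
    lemma₂ : ∀ X → suc (X + X) ≡ suc (2 * X) + 0
    lemma₂ = solve-∀

  upperHalf : ∀ {y u} → y + u < 2 * y → suc u ≤ y
  upperHalf {y} {u} lt = ≤-shift y 0 lt (lemma₁ y u) (lemma₂ y)
    where
    lemma₁ : ∀ y u → suc u + y + 0 ≡ suc (y + u)
    lemma₁ = solve-∀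
    lemma₂ : ∀ y → 2 * y ≡ y + y
    lemma₂ = solve-∀

  pastCentre : ∀ {y} c → y + c ≤ suc (2 * y) → c ≤ suc y
  pastCentre {y} c le = ≤-shift y 0 le (lemma₁ y c) (lemma₂ y)
    where
    lemma₁ : ∀ y c → c + y + 0 ≡ y + c
    lemma₁ = solve-∀
    lemma₂ : ∀ y → suc (2 * y) ≡ suc y + y
    lemma₂ = solve-∀

  middle-excess : ∀ {d X y} → 2 * d + 13 ≤ X → 2 * y ≤ X → X ≤ suc (2 * y) →
                  ∃[ w ] ∃[ v ] y ≡ d + 6 + w + v × X ≡ y + (d + 7) + w
  middle-excess {d} {X} {y} dX lo hi =
    let w , X≡ = excess (centre {d} {X} {y} dX lo)
        v , y≡ = excess (≤-pred (pastCentre (suc (d + 6 + w)) (subst (_≤ suc (2 * y)) (trans X≡ (lemma d y w)) hi)))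
    in w , v , y≡ , X≡
    where
    lemma : ∀ d y w → y + (d + 7) + w ≡ y + suc (d + 6 + w)
    lemma = solve-∀

  -- The remainder `y` is the inner leg, falls into the gap at half of `X`, is the outer leg, or is
  -- at least `X`. The case `y = X` belongs to `beyond`, so that in `above` the inner leg `u` is
  -- positive and a one-box core fits.
  data Position (X y : ℕ) : Set where
    below  : ∀ z → X ≡ 2 * y + 2 + z → Position X y
    middle : 2 * y ≤ X → X ≤ suc (2 * y) → Position X y
    above  : ∀ u z → 0 < u → y ≡ suc u + z → X ≡ y + u → Position X y
    beyond : ∀ e → y ≡ X + e → Position X y

  position : ∀ X y → 0 < X → Position X y
  position X y 0<X with 2 * y + 2 ≤? X
  ... | yes le with excess le
  ...   | z , eq = below z eq
  position X y 0<X | no ¬below with 2 * y ≤? X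
  ... | yes le = middle le (≤-pred (subst (X <_) (lemma y) (≰⇒> ¬below)))
    where
    lemma : ∀ y → 2 * y + 2 ≡ suc (suc (2 * y))
    lemma = solve-∀
  ... | no ¬le with X ≤? y
  ...   | yes X≤y with excess X≤y
  ...     | e , eq = beyond e eq
  position X y 0<X | no _ | no ¬le | no X≰y with excess (≰⇒> X≰y)
  ... | u , refl with excess (upperHalf {y} {suc u} (subst (_< 2 * y) (sym (+-suc y u)) (≰⇒> ¬le)))
  ...   | z , eq = above (suc u) z (s≤s z≤n) eq (sym (+-suc y u))

  -- With `P = X + d` the sizes are `2 * P + 3` and `2 * P + 4`, and the content is
  -- `1 + d * (P + 2) + y`.
  OddContent EvenContent : ℕ → ℕ → ℕ → Set
  OddContent  d X y = HasContent (2 * X + 2 * d + 3) (d * X + suc d * suc d + y)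
  EvenContent d X y = HasContent (2 * X + 2 * d + 4) (d * X + suc d * suc d + y)

  transport : ∀ (P : ℕ → ℕ → Set) {X X′ y y′} → X ≡ X′ → y ≡ y′ → P X′ y′ → P X y
  transport P X≡ y≡ = subst₂ P (sym X≡) (sym y≡)

  transport′ : ∀ (P : ℕ → ℕ → Set) f {X y y′} → X ≡ f y → y ≡ y′ → P (f y′) y′ → P X y
  transport′ P f X≡ y≡ = transport P (trans X≡ (cong f y≡)) y≡

  transport″ : ∀ (P : ℕ → ℕ → Set) f {X X′ y} → X ≡ X′ → y ≡ f X → P X′ (f X′) → P X y
  transport″ P f X≡ y≡ = transport P X≡ (trans y≡ (cong f X≡))

  odd-below : ∀ d y z → OddContent d (2 * y + 2 + z) y
  odd-below d y z = lower d y z ∅ z≤n (size d y z) (value d y z)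
    where
    size : ∀ d y z → 2 * (2 * y + 2 + z) + 2 * d + 3 ≡ 2 * (2 * y + 2 + z) + (2 * d + 3) + 0
    size = solve-∀
    value : ∀ d y z →
            d * (2 * y + 2 + z) + suc d * suc d + y + 0 ≡
            d * (2 * y + 2 + z) + y + suc d * suc d + 0
    value = solve-∀

  odd-above : ∀ d u z → OddContent d (suc u + z + u) (suc u + z)
  odd-above d u z = upper d u z ∅ z≤n (size d u z) (value d u z)
    where
    size : ∀ d u z → 2 * (suc u + z + u) + 2 * d + 3 ≡ 2 * (2 * u + 1 + z) + (2 * d + 3) + 0
    size = solve-∀
    value : ∀ d u z →
            d * (suc u + z + u) + suc d * suc d + (suc u + z) + 0 ≡
            d * (2 * u + 1 + z) + (u + 1 + z) + suc d * suc d + 0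
    value = solve-∀

  -- The core `1-1` uses up one unit of leg, which costs `d`, and has content -1. The outer leg
  -- therefore becomes `y + d + 1`, beyond the gap.
  odd-middle : ∀ d v w → OddContent d (d + 6 + w + v + (d + 7) + w) (d + 6 + w + v)
  odd-middle d v w = upper d (w + 5) (v + (2 * d + 1)) 1-1 (≤-trans (s≤s (s≤s z≤n)) (m≤n+m 5 w)) (size d v w) (value d v w)
    where
    size : ∀ d v w → 2 * (d + 6 + w + v + (d + 7) + w) + 2 * d + 3 ≡ 2 * (2 * (w + 5) + 1 + (v + (2 * d + 1))) + (2 * d + 3) + 2
    size = solve-∀
    value : ∀ d v w →
            d * (d + 6 + w + v + (d + 7) + w) + suc d * suc d + (d + 6 + w + v) + 1 ≡
            d * (2 * (w + 5) + 1 + (v + (2 * d + 1))) + ((w + 5) + 1 + (v + (2 * d + 1))) + suc d * suc d + 0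
    value = solve-∀

  odd-beyond₀ : ∀ d z → OddContent d (13 + z) (13 + z + 0)
  odd-beyond₀ d z = upper d 0 (12 + z) ∅ z≤n (size d z) (value d z)
    where
    size : ∀ d z → 2 * (13 + z) + 2 * d + 3 ≡ 2 * (2 * 0 + 1 + (12 + z)) + (2 * d + 3) + 0
    size = solve-∀
    value : ∀ d z →
            d * (13 + z) + suc d * suc d + (13 + z + 0) + 0 ≡
            d * (2 * 0 + 1 + (12 + z)) + (0 + 1 + (12 + z)) + suc d * suc d + 0
    value = solve-∀

  -- The core `2-2` would leave an inner leg of 1, too short for it. The content 9 of `5-1` lowers
  -- the outer leg to `X - 8`, and the inner leg is 5, exactly the side of this core.
  odd-beyond₁-zero : ∀ z → OddContent 0 (16 + z) (16 + z + 1)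
  odd-beyond₁-zero z = upper 0 5 (2 + z) 5-1 ≤-refl (size z) (value z)
    where
    size : ∀ z → 2 * (16 + z) + 2 * 0 + 3 ≡ 2 * (2 * 5 + 1 + (2 + z)) + (2 * 0 + 3) + 6
    size = solve-∀
    value : ∀ z →
            0 * (16 + z) + suc 0 * suc 0 + (16 + z + 1) + 0 ≡
            0 * (2 * 5 + 1 + (2 + z)) + (5 + 1 + (2 + z)) + suc 0 * suc 0 + 9
    value = solve-∀

  -- Raising the parameter by one and inserting `2-2` makes the inner leg one more than the original
  -- parameter, so `2-2` fits once that parameter is positive.
  odd-beyond₁-suc : ∀ d z → OddContent (suc d) (2 * suc d + 13 + z) (2 * suc d + 13 + z + 1)
  odd-beyond₁-suc d z = lower (suc (suc d)) (suc (suc d)) (6 + z) 2-2 (s≤s (s≤s z≤n)) (size d z) (value d z)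
    where
    size : ∀ d z → 2 * (2 * suc d + 13 + z) + 2 * (suc d) + 3 ≡ 2 * (2 * (suc (suc d)) + 2 + (6 + z)) + (2 * (suc (suc d)) + 3) + 4
    size = solve-∀
    value : ∀ d z →
            (suc d) * (2 * suc d + 13 + z) + suc (suc d) * suc (suc d) + (2 * suc d + 13 + z + 1) + 0 ≡
            (suc (suc d)) * (2 * (suc (suc d)) + 2 + (6 + z)) + (suc (suc d)) + suc (suc (suc d)) * suc (suc (suc d)) + 0
    value = solve-∀

  -- No leg exceeds `X`, so the parameter is raised to `d + 1`. With the core `1-1` the inner leg is
  -- then exactly `y - X`, which is at least the side 2 of the core.
  odd-beyond₂ : ∀ d e z → OddContent d (2 * e + 13 + z) (2 * e + 13 + z + suc (suc e))
  odd-beyond₂ d e z = lower (suc d) (2 + e) (5 + z) 1-1 (s≤s (s≤s z≤n)) (size d e z) (value d e z)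
    where
    size : ∀ d e z → 2 * (2 * e + 13 + z) + 2 * d + 3 ≡ 2 * (2 * (2 + e) + 2 + (5 + z)) + (2 * (suc d) + 3) + 2
    size = solve-∀
    value : ∀ d e z →
            d * (2 * e + 13 + z) + suc d * suc d + (2 * e + 13 + z + suc (suc e)) + 1 ≡
            (suc d) * (2 * (2 + e) + 2 + (5 + z)) + (2 + e) + suc (suc d) * suc (suc d) + 0
    value = solve-∀

  -- Hooks with arm minus leg equal to d and d + 1 and total leg length X around
  -- the empty core reach all y ≤ X except X / 2. The other values of y are
  -- reached with the cores (1,1), (2,2) and (5,1), sometimes with d + 1 for d.
  odd-content : ∀ d {X y} → 2 * d + 13 ≤ X → y ≤ X + suc d → 16 ≤ X + d ⊎ y < X + d → Position X y → OddContent d X y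
  odd-content d dX y≤ big (below z X≡) = transport (OddContent d) X≡ refl (odd-below d _ z)
  odd-content d dX y≤ big (above u z _ y≡ X≡) = transport′ (OddContent d) (_+ u) X≡ y≡ (odd-above d u z)
  odd-content d {X} {y} dX y≤ big (middle lo hi) =
    let w , v , y≡ , X≡ = middle-excess {d} {X} {y} dX lo hi
    in transport′ (OddContent d) (λ y → y + (d + 7) + w) X≡ y≡ (odd-middle d v w)
  odd-content d dX y≤ big (beyond 0 y≡) =
    let z , X≡ = excess-twice {d} 0 z≤n dX in transport″ (OddContent d) (_+ 0) X≡ y≡ (odd-beyond₀ d z)
  odd-content 0 {X} dX y≤ (inj₁ 16≤) (beyond 1 y≡) =
    let z , X≡ = excess (subst (16 ≤_) (+-identityʳ X) 16≤)
    in transport″ (OddContent 0) (_+ 1) X≡ y≡ (odd-beyond₁-zero z)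
  odd-content 0 {X} dX y≤ (inj₂ y<) (beyond 1 y≡) =
    contradiction (+-cancelˡ-< X 1 0 (subst (_< X + 0) y≡ y<)) λ ()
  odd-content (suc d) dX y≤ big (beyond 1 y≡) =
    let z , X≡ = excess-twice (suc d) ≤-refl dX in transport″ (OddContent (suc d)) (_+ 1) X≡ y≡ (odd-beyond₁-suc d z)
  odd-content d {X} dX y≤ big (beyond (suc (suc e)) y≡) =
    let e≤d    = ≤-trans (n≤1+n e) (≤-pred (+-cancelˡ-≤ X (suc (suc e)) (suc d) (subst (_≤ X + suc d) y≡ y≤)))
        z , X≡ = excess-twice e e≤d dX
    in transport″ (OddContent d) (_+ suc (suc e)) X≡ y≡ (odd-beyond₂ d e z)

  -- An inner leg 0 cannot hold even one box. The core `1-1-1` uses up one unit of leg and has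
  -- content -3, which lengthens the inner leg to `d + 3`.
  even-zero : ∀ d z → EvenContent d (2 * d + 13 + z) 0
  even-zero d z = lower d (d + 3) (4 + z) 1-1-1 (m≤n+m 3 d) (size d z) (value d z)
    where
    size : ∀ d z → 2 * (2 * d + 13 + z) + 2 * d + 4 ≡ 2 * (2 * (d + 3) + 2 + (4 + z)) + (2 * d + 3) + 3
    size = solve-∀
    value : ∀ d z →
            d * (2 * d + 13 + z) + suc d * suc d + 0 + 3 ≡
            d * (2 * (d + 3) + 2 + (4 + z)) + (d + 3) + suc d * suc d + 0
    value = solve-∀

  even-below : ∀ d y z → EvenContent d (2 * suc y + 2 + z) (suc y)
  even-below d y z = lower d (suc y) z □ (s≤s z≤n) (size d y z) (value d y z)
    where
    size : ∀ d y z → 2 * (2 * suc y + 2 + z) + 2 * d + 4 ≡ 2 * (2 * (suc y) + 2 + z) + (2 * d + 3) + 1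
    size = solve-∀
    value : ∀ d y z →
            d * (2 * suc y + 2 + z) + suc d * suc d + suc y + 0 ≡
            d * (2 * (suc y) + 2 + z) + (suc y) + suc d * suc d + 0
    value = solve-∀

  even-above : ∀ d u z → 0 < u → EvenContent d (suc u + z + u) (suc u + z)
  even-above d u z 0<u = upper d u z □ 0<u (size d u z) (value d u z)
    where
    size : ∀ d u z → 2 * (suc u + z + u) + 2 * d + 4 ≡ 2 * (2 * u + 1 + z) + (2 * d + 3) + 1
    size = solve-∀
    value : ∀ d u z →
            d * (suc u + z + u) + suc d * suc d + (suc u + z) + 0 ≡
            d * (2 * u + 1 + z) + (u + 1 + z) + suc d * suc d + 0
    value = solve-∀

  even-middle : ∀ d v w → EvenContent d (d + 6 + w + v + (d + 7) + w) (d + 6 + w + v)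
  even-middle d v w = upper d (w + 3) (v + (2 * d + 5)) 1-1-1 (m≤n+m 3 w) (size d v w) (value d v w)
    where
    size : ∀ d v w → 2 * (d + 6 + w + v + (d + 7) + w) + 2 * d + 4 ≡ 2 * (2 * (w + 3) + 1 + (v + (2 * d + 5))) + (2 * d + 3) + 3
    size = solve-∀
    value : ∀ d v w →
            d * (d + 6 + w + v + (d + 7) + w) + suc d * suc d + (d + 6 + w + v) + 3 ≡
            d * (2 * (w + 3) + 1 + (v + (2 * d + 5))) + ((w + 3) + 1 + (v + (2 * d + 5))) + suc d * suc d + 0
    value = solve-∀

  -- Origin of the constant 16: with `5-2` the inner leg is 6 and the outer leg is `X - 9`, which
  -- must be at least 7. The core `2-2-1`, used for positive parameters, would leave an inner leg of
  -- 2, below its side 3.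
  even-beyond₀-zero : ∀ z → EvenContent 0 (16 + z) (16 + z + 0)
  even-beyond₀-zero z = upper 0 6 z 5-2 (n≤1+n 5) (size z) (value z)
    where
    size : ∀ z → 2 * (16 + z) + 2 * 0 + 4 ≡ 2 * (2 * 6 + 1 + z) + (2 * 0 + 3) + 7
    size = solve-∀
    value : ∀ z →
            0 * (16 + z) + suc 0 * suc 0 + (16 + z + 0) + 0 ≡
            0 * (2 * 6 + 1 + z) + (6 + 1 + z) + suc 0 * suc 0 + 9
    value = solve-∀

  even-beyond₀-suc : ∀ d z → EvenContent (suc d) (2 * suc d + 13 + z) (2 * suc d + 13 + z + 0)
  even-beyond₀-suc d z = lower (suc (suc d)) (3 + d) (4 + z) 2-2-1 (m≤m+n 3 d) (size d z) (value d z)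
    where
    size : ∀ d z → 2 * (2 * suc d + 13 + z) + 2 * (suc d) + 4 ≡ 2 * (2 * (3 + d) + 2 + (4 + z)) + (2 * (suc (suc d)) + 3) + 5
    size = solve-∀
    value : ∀ d z →
            (suc d) * (2 * suc d + 13 + z) + suc (suc d) * suc (suc d) + (2 * suc d + 13 + z + 0) + 2 ≡
            (suc (suc d)) * (2 * (3 + d) + 2 + (4 + z)) + (3 + d) + suc (suc (suc d)) * suc (suc (suc d)) + 0
    value = solve-∀

  even-beyond₁ : ∀ d e z → EvenContent d (2 * e + 13 + z) (2 * e + 13 + z + suc e)
  even-beyond₁ d e z = lower (suc d) (3 + e) (3 + z) 1-1-1 (m≤m+n 3 e) (size d e z) (value d e z)
    where
    size : ∀ d e z → 2 * (2 * e + 13 + z) + 2 * d + 4 ≡ 2 * (2 * (3 + e) + 2 + (3 + z)) + (2 * (suc d) + 3) + 3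
    size = solve-∀
    value : ∀ d e z →
            d * (2 * e + 13 + z) + suc d * suc d + (2 * e + 13 + z + suc e) + 3 ≡
            (suc d) * (2 * (3 + e) + 2 + (3 + z)) + (3 + e) + suc (suc d) * suc (suc d) + 0
    value = solve-∀

  -- The same for even size, with the cores (1), (1,1,1), (2,2,1) and (5,2).
  even-content : ∀ d {X y} → 2 * d + 13 ≤ X → y ≤ X + suc d → 16 ≤ X + d ⊎ y < X + d → Position X y → EvenContent d X y
  even-content d {y = zero} dX y≤ big (below _ _) =
    let z , X≡ = excess-twice d ≤-refl dX in transport (EvenContent d) X≡ refl (even-zero d z)
  even-content d {y = suc y} dX y≤ big (below z X≡) = transport (EvenContent d) X≡ refl (even-below d y z)
  even-content d dX y≤ big (above u z 0<u y≡ X≡) = transport′ (EvenContent d) (_+ u) X≡ y≡ (even-above d u z 0<u)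
  even-content d {X} {y} dX y≤ big (middle lo hi) =
    let w , v , y≡ , X≡ = middle-excess {d} {X} {y} dX lo hi
    in transport′ (EvenContent d) (λ y → y + (d + 7) + w) X≡ y≡ (even-middle d v w)
  even-content 0 {X} dX y≤ (inj₁ 16≤) (beyond 0 y≡) =
    let z , X≡ = excess (subst (16 ≤_) (+-identityʳ X) 16≤)
    in transport″ (EvenContent 0) (_+ 0) X≡ y≡ (even-beyond₀-zero z)
  even-content 0 {X} dX y≤ (inj₂ y<) (beyond 0 y≡) = contradiction (subst (_< X + 0) y≡ y<) (n≮n _)
  even-content (suc d) dX y≤ big (beyond 0 y≡) =
    let z , X≡ = excess-twice (suc d) ≤-refl dX in transport″ (EvenContent (suc d)) (_+ 0) X≡ y≡ (even-beyond₀-suc d z)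
  even-content d {X} dX y≤ big (beyond (suc e) y≡) =
    let z , X≡ = excess-twice e (≤-pred (+-cancelˡ-≤ X (suc e) (suc d) (subst (_≤ X + suc d) y≡ y≤))) dX
    in transport″ (EvenContent d) (_+ suc e) X≡ y≡ (even-beyond₁ d e z)

-- Choosing the parameter by division, and the small cases.

module Existence where
  open Diagrams using (HasContent)
  open Realisation
  open Exchanges using (triangle)
  open import Data.Nat
  open import Data.Nat.Properties
  open import Data.Nat.DivMod using (m≡m%n+[m/n]*n; m%n<n)
  open import Data.Nat.Combinatorics using (_C_; nC1≡n; nCk+nC[k+1]≡[n+1]C[k+1])
  open import Data.Nat.Tactic.RingSolver using (solve-∀)
  open import Data.Product using (∃-syntax; _,_)
  open import Data.Sum using (_⊎_; inj₁; inj₂)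
  open import Relation.Nullary using (yes; no; contradiction)
  open import Relation.Binary.PropositionalEquality

  nC2≡triangle : ∀ n → n C 2 ≡ triangle n
  nC2≡triangle zero    = refl
  nC2≡triangle (suc n) = trans (sym (nCk+nC[k+1]≡[n+1]C[k+1] n 1)) (cong₂ _+_ (nC1≡n n) (nC2≡triangle n))

  2*triangle : ∀ n → 2 * triangle (suc n) ≡ suc n * n
  2*triangle zero    = refl
  2*triangle (suc n) = trans (lemma₁ n (triangle (suc n))) (trans (cong (λ m → 2 * suc n + m) (2*triangle n)) (lemma₂ n))
    where
    lemma₁ : ∀ n t → 2 * (suc n + t) ≡ 2 * suc n + 2 * t
    lemma₁ = solve-∀
    lemma₂ : ∀ n → 2 * suc n + suc n * n ≡ suc (suc n) * suc n
    lemma₂ = solve-∀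

  data HasHalf (P n : ℕ) : Set where
    odd  : n ≡ 2 * P + 3 → HasHalf P n
    even : n ≡ 2 * P + 4 → HasHalf P n

  half : ∀ {n} → 3 ≤ n → ∃[ P ] HasHalf P n
  half {n} 3≤n with excess 3≤n
  ... | m , refl = go m
    where
    2*suc : ∀ P c → 2 + (2 * P + c) ≡ 2 * suc P + c
    2*suc = solve-∀
    go : ∀ m → ∃[ P ] HasHalf P (3 + m)
    go 0             = 0 , odd refl
    go 1             = 0 , even refl
    go (suc (suc m)) with go m
    ... | P , odd eq = suc P , odd (trans (cong (2 +_) eq) (2*suc P 3))
    ... | P , even eq = suc P , even (trans (cong (2 +_) eq) (2*suc P 4))

  HasHalf-≤ : ∀ {P n} → HasHalf P n → n ≤ 2 * P + 4
  HasHalf-≤ {P} (odd refl) = +-monoʳ-≤ (2 * P) (n≤1+n 3)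
  HasHalf-≤     (even refl) = ≤-refl

  half-≥ : ∀ {P n} c → HasHalf P n → 2 * c + 3 ≤ n → c ≤ P
  half-≥ {P} c hP le = halve (≤-shift 3 0 (≤-trans le (HasHalf-≤ hP)) (+-identityʳ _) (lemma P))
    where
    lemma : ∀ P → 2 * P + 4 ≡ suc (2 * P) + 3
    lemma = solve-∀

  -- Parameter 0 with inner leg `1 + y`. This serves `a = 3` and `a = 4`, where `P` may be below 13.
  -- Starting at content 2 keeps the inner leg positive, as the one-box core of even sizes requires.
  small-content : ∀ {n P} y → 2 * (2 + y) ≤ P → HasHalf P n → HasContent n (2 + y)
  small-content {P = P} y le hP with excess le
  ... | z , P≡ = go hP
    where
    P≡′ : P ≡ 2 * suc y + 2 + z
    P≡′ = trans P≡ (cong (_+ z) (lemma y))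
      where
      lemma : ∀ y → 2 * (2 + y) ≡ 2 * suc y + 2
      lemma = solve-∀
    size : ∀ c → 2 * P + 2 * 0 + c ≡ 2 * P + c
    size c = cong (_+ c) (+-identityʳ (2 * P))
    go : ∀ {n} → HasHalf P n → HasContent n (2 + y)
    go (odd refl) = subst (λ n → HasContent n (2 + y)) (size 3) (transport (OddContent 0) P≡′ refl (odd-below 0 (suc y) z))
    go (even refl) = subst (λ n → HasContent n (2 + y)) (size 4) (transport (EvenContent 0) P≡′ refl (even-below 0 y z))

  large-content : ∀ {n k} X d y → 2 * d + 13 ≤ X → y ≤ X + suc d → 16 ≤ X + d ⊎ y < X + d →
                  HasHalf (X + d) n → k ≡ suc (y + d * (X + d + 2)) → HasContent n k
  large-content {n} {k} X d y dX y≤ big hP k≡ = go hP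
    where
    X-position : Position X y
    X-position = position X y (≤-trans (s≤s z≤n) (≤-trans (m≤n+m 13 (2 * d)) dX))
    size : ∀ X d c → 2 * X + 2 * d + c ≡ 2 * (X + d) + c
    size = solve-∀
    value : ∀ X d y → d * X + suc d * suc d + y ≡ suc (y + d * (X + d + 2))
    value = solve-∀
    go : HasHalf (X + d) n → HasContent n k
    go (odd refl) = subst₂ HasContent (size X d 3) (trans (value X d y) (sym k≡)) (odd-content d dX y≤ big X-position)
    go (even refl) = subst₂ HasContent (size X d 4) (trans (value X d y) (sym k≡)) (even-content d dX y≤ big X-position)

  -- For `X = P - d` the conclusion reads `2 * d + 13 ≤ X`. Put `a = 7 + j`. If `P ≤ 3 * d + 12`,
  -- then `6 * d ≥ 3 * a - 13`, and with `2 * (P + 2) ≥ 3 * a + 15` the number `12 * d * (P + 2)`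
  -- grows like `9 * a²`, whereas `12 * triangle a = 6 * a * (a - 1)`.
  quotient-bound : ∀ {j P d m} → 3 * (7 + j) + 15 ≤ 2 * P + 4 → m < triangle (7 + j) → d * (P + 2) ≤ m → 3 * d + 13 ≤ P
  quotient-bound {j} {P} {d} {m} jP m< dP with 3 * d + 13 ≤? P
  ... | yes le = le
  ... | no  gt = contradiction absurd (m+1+n≰m (6 * ((7 + j) * (6 + j))))
    where
    open ≤-Reasoning
    P≤ : P ≤ 3 * d + 12
    P≤ = ≤-pred (subst (P <_) (+-suc (3 * d) 12) (≰⇒> gt))
    8+3j≤6d : 8 + 3 * j ≤ 6 * d
    8+3j≤6d = ≤-shift 28 0 (≤-trans jP (+-monoˡ-≤ 4 (*-monoʳ-≤ 2 P≤))) (lemma₁ j) (lemma₂ d)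
      where
      lemma₁ : ∀ j → 8 + 3 * j + 28 + 0 ≡ 3 * (7 + j) + 15
      lemma₁ = solve-∀
      lemma₂ : ∀ d → 2 * (3 * d + 12) + 4 ≡ 6 * d + 28
      lemma₂ = solve-∀
    -- The surplus is the exact difference of the two bounds, a polynomial in `j` with positive
    -- coefficients; `suc` marks it as nonzero.
    absurd : 6 * ((7 + j) * (6 + j)) + suc (47 + 54 * j + 3 * (j * j)) ≤ 6 * ((7 + j) * (6 + j))
    absurd = begin
      6 * ((7 + j) * (6 + j)) + suc (47 + 54 * j + 3 * (j * j))
        ≡⟨ lemma₁ j ⟩
      (8 + 3 * j) * (3 * (7 + j) + 15) + 12
        ≤⟨ +-monoˡ-≤ 12 (*-mono-≤ 8+3j≤6d jP) ⟩
      6 * d * (2 * P + 4) + 12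
        ≡⟨ lemma₂ d P ⟩
      12 * suc (d * (P + 2))
        ≤⟨ *-monoʳ-≤ 12 (≤-trans (s≤s dP) m<) ⟩
      12 * triangle (7 + j)
        ≡⟨ *-assoc 6 2 (triangle (7 + j)) ⟩
      6 * (2 * triangle (7 + j))
        ≡⟨ cong (6 *_) (2*triangle (6 + j)) ⟩
      6 * ((7 + j) * (6 + j)) ∎
      where
      lemma₁ : ∀ j → 6 * ((7 + j) * (6 + j)) + suc (47 + 54 * j + 3 * (j * j)) ≡
               (8 + 3 * j) * (3 * (7 + j) + 15) + 12
      lemma₁ = solve-∀
      lemma₂ : ∀ d P → 6 * d * (2 * P + 4) + 12 ≡ 12 * suc (d * (P + 2))
      lemma₂ = solve-∀

  quotient-content : ∀ {n P y d r} j → HasHalf P n → 16 ≤ P → 3 * (7 + j) + 15 ≤ n → y < triangle (7 + j) →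
                     y ≡ r + d * (P + 2) → r < P + 2 → HasContent n (suc y)
  quotient-content {n} {P} {y} {d} {r} j hP 16≤P j≤ y< y≡ r< =
    let o , P≡ = excess (quotient-bound {j} {P} {d} (≤-trans j≤ (HasHalf-≤ hP)) y<
                          (≤-trans (m≤n+m (d * (P + 2)) r) (≤-reflexive (sym y≡))))
        X  = 2 * d + 13 + o
        P≡X+d = trans P≡ (lemma₁ d o)
    in large-content X d r
         (m≤m+n (2 * d + 13) o)
         (≤-pred (subst (r <_) (trans (cong (_+ 2) P≡) (lemma₂ d o)) r<))
         (inj₁ (subst (16 ≤_) P≡X+d 16≤P))
         (subst (λ P → HasHalf P n) P≡X+d hP)
         (cong suc (trans y≡ (cong (λ Q → r + d * (Q + 2)) P≡X+d)))
    where
    lemma₁ : ∀ d o → 3 * d + 13 + o ≡ 2 * d + 13 + o + d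
    lemma₁ = solve-∀
    lemma₂ : ∀ d o → 3 * d + 13 + o + 2 ≡ suc (2 * d + 13 + o + suc d)
    lemma₂ = solve-∀

  -- For `a = 5` and `a = 6` the bound `16 ≤ P` may fail, but all contents are at most `P`. Then
  -- `y < P`, and the remainders needing that bound do not occur.
  first-content : ∀ {n P} y → HasHalf P n → 13 ≤ P → y < P → HasContent n (suc y)
  first-content {n} {P} y hP 13≤P y<P = large-content P 0 y 13≤P (≤-trans (<⇒≤ y<P) (m≤m+n P 1))
    (inj₂ (≤-trans y<P (m≤m+n P 0))) (subst (λ P → HasHalf P n) (sym (+-identityʳ P)) hP)
    (cong suc (sym (+-identityʳ y)))

  -- P is the total leg length available to two hooks with arm equal to leg; a
  -- large content is written as 1 + d (P + 2) + r with r < P + 2.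
  half-content : ∀ {n P y} a → HasHalf P n → 3 ≤ a → 3 * a + 15 ≤ n → 2 + y ≤ triangle a → HasContent n (2 + y)
  -- `2 * triangle a` is 6 for `a = 3` and 12 for `a = 4`, while `3 * a + 15 ≤ n` gives `P ≥ 10` and
  -- `P ≥ 12`.
  half-content {y = y} 3 hP _ a≤ k≤ = small-content y
    (≤-trans (*-monoʳ-≤ 2 k≤) (≤-trans (m≤n+m 6 4) (half-≥ 10 hP (≤-trans (n≤1+n 23) a≤)))) hP
  half-content {y = y} 4 hP _ a≤ k≤ = small-content y (≤-trans (*-monoʳ-≤ 2 k≤) (half-≥ 12 hP a≤)) hP
  half-content {y = y} 5 hP _ a≤ k≤ =
    let 13≤P = half-≥ 13 hP (≤-trans (n≤1+n 29) a≤)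
    in first-content (suc y) hP 13≤P (≤-trans k≤ (≤-trans (m≤n+m 10 3) 13≤P))
  half-content {y = y} 6 hP _ a≤ k≤ =
    let 15≤P = half-≥ 15 hP a≤
    in first-content (suc y) hP (≤-trans (m≤n+m 13 2) 15≤P) (≤-trans k≤ 15≤P)
  -- From `a = 7` on, `n ≥ 36` gives `P ≥ 16`, and division by `P + 2` takes over.
  half-content {P = P} {y} (suc (suc (suc (suc (suc (suc (suc j))))))) hP _ a≤ k≤ =
    quotient-content {d = suc y / (P + 2)} j hP (half-≥ 16 hP (≤-trans (≤-trans (m≤m+n 35 (suc (3 * j))) (≤-reflexive (lemma j))) a≤)) a≤ k≤
      (m≡m%n+[m/n]*n (suc y) (P + 2)) (m%n<n (suc y) (P + 2))
    where
    instance
      P+2≢0 : NonZero (P + 2)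
      P+2≢0 = >-nonZero (≤-trans (s≤s z≤n) (m≤n+m 2 P))
    lemma : ∀ j → 35 + suc (3 * j) ≡ 3 * (7 + j) + 15
    lemma = solve-∀
  half-content 1 _ (s≤s ()) _ _
  half-content 2 _ (s≤s (s≤s ())) _ _

  content-exists : ∀ {n k} a → 3 ≤ a → 3 * a + 15 ≤ n → 2 ≤ k → k ≤ triangle a → HasContent n k
  content-exists a 3≤a a≤ (s≤s (s≤s z≤n)) k≤ =
    let _ , hP = half (≤-trans (≤-trans (m≤n+m 3 12) (m≤n+m 15 (3 * a))) a≤) in half-content a hP 3≤a a≤ k≤

-- The intervals between consecutive binomial coefficients.

open import Data.Nat using (ℕ; _≤_; _∸_; _+_; suc)
open import Data.Nat.DivMod using (_/_; _%_)
open import Data.Nat.Combinatorics using (_C_)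
open import Relation.Binary.PropositionalEquality using (_≡_)
open import Data.Nat using (_*_; s≤s; z≤n)
open import Data.Nat.Properties
  using (≤-trans; ≤-reflexive; +-monoˡ-≤; *-monoˡ-≤; *-comm; m∸n+n≡m; m≤m+n)
open import Data.Nat.DivMod using (m/n*n≤m)
open import Relation.Binary.PropositionalEquality using (refl; subst)

theorem3p1 : (n : ℕ) → 24 ≤ n →
    (a : ℕ) → 3 ≤ a → a ≤ (n ∸ 15) / 3 → (n ∸ a) % 2 ≡ 1 →
    (k : ℕ) → ((a ∸ 1) C 2) + 1 ≤ k → k ≤ a C 2 →
    IsCayEigenvalue n (ℕtoℚ k)
theorem3p1 n 24≤n a 3≤a a≤ _ k lo hi =
  conclude (Existence.content-exists a 3≤a 3a+15≤n (2≤k 3≤a lo) (subst (k ≤_) (Existence.nC2≡triangle a) hi))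
  where
  3a+15≤n : 3 * a + 15 ≤ n
  3a+15≤n = ≤-trans
    (+-monoˡ-≤ 15 (≤-trans (≤-reflexive (*-comm 3 a)) (≤-trans (*-monoˡ-≤ 3 a≤) (m/n*n≤m (n ∸ 15) 3))))
    (≤-reflexive (m∸n+n≡m (≤-trans (m≤m+n 15 9) 24≤n)))
  2≤k : ∀ {a} → 3 ≤ a → ((a ∸ 1) C 2) + 1 ≤ k → 2 ≤ k
  2≤k {suc a} (s≤s (s≤s (s≤s z≤n))) lo rewrite Existence.nC2≡triangle a =
    ≤-trans (+-monoˡ-≤ 1 (s≤s z≤n)) lo
  conclude : ∀ {n k} → Diagrams.HasContent n k → IsCayEigenvalue n (ℕtoℚ k)
  -- `fromℤ (+ k)` unfolds to `ℕtoℚ k`, so rewriting the content is enough.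
  conclude {n} (Diagrams.hasContent hs desc refl content≡k) =
    subst (λ c → IsCayEigenvalue n (Eigenvectors.fromℤ c)) content≡k (Eigenvectors.content-eigenvalue desc)
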